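{- Let $w\ge0$ be the look-ahead window size. The online algorithm $\mathbf{GCSR_s^{(w)}}$ achieves a competitive ratio of $2-\alpha_s$ for $\mathbf{CP_i}$, where $$\alpha_s\triangleq\min\left(1,\,w\,d_{\min}P_{\min}/\beta_s\right)\in[0,1]$$ is a normalized look-ahead window size and $d_{\min}\triangleq\min_t\{d_t(1)-d_t(0)\}$. Hence $\mathbf{GCSR^{(w)}}$ achieves the same competitive ratio $2-\alpha_s$ for $\mathbf{CP}$. Further, no deterministic online algorithm with a look-ahead window $w$ can achieve a smaller competitive ratio (for $\mathbf{CP_i}$, and also for $\mathbf{CP}$).
   Context: Notation: $[z]^+=\max(0,z)$; $\mathbb{N}^0$ is the set of non-negative integers. Inputs over slots $t=1,\dots,T$: workload $a(t)\ge0$; grid price $p(t)$ with $0\le P_{\min}\le p(t)\le P_{\max}$; total power consumption functions $g_t(x,a)\ge 0$, increasing (non-decreasing) and convex in $x$ and $a$. Put $d_t(x)=g_t(x,a(t))$. Server switching cost: $\beta_s>0$. $\mathbf{CP}$: minimize $\mathrm{C_{CP}}(\boldsymbol x)=\sum_{t=1}^{T}\{p(t)d_t(x(t))+\beta_s[x(t)-x(t-1)]^+\}$ over $x(t)\in\mathbb{N}^0$ subject to $x(t)\ge a(t)$, $x(0)=0$. Let $M=\max_{1\le t\le T}\lceil a(t)\rceil$. For $1\le i\le M$ put $a_i(t)=\min\{1,\max\{0,a(t)-(i-1)\}\}$ and $d_t^i=d_t(i)-d_t(i-1)$. $\mathbf{CP_i}$: minimize $\mathrm{C_{CP_i}}(\boldsymbol{x}_i)=\sum_{t=1}^{T}\{p(t)d_t^i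 x_i(t)+\beta_s[x_i(t)-x_i(t-1)]^+\}$ over $x_i(t)\in\{0,1\}$ subject to $x_i(t)\ge a_i(t)$, $x_i(0)=0$. Online setting: an online algorithm with look-ahead window $w$ makes its decision at time $t$ knowing only the inputs $a(\tau),p(\tau),g_\tau$ for $1\le\tau\le t+w$ (truncated at $T$). It achieves competitive ratio $\gamma$ if for all inputs its cost is at most $\gamma$ times the offline optimal cost for the same input. Algorithm $\mathbf{GCSR_s^{(w)}}$ for $\mathbf{CP_i}$: initialize $C_i=0$, $x_i(0)=0$. At each time $t$, set $\tau'=\min\{t'\in[t,t+w]: C_i+\sum_{\tau=t}^{t'}p(\tau)d_\tau^i\ge\beta_s\}$ ($\tau'=\mathrm{NULL}$ if there is no such $t'$). If $a_i(t)>0$: set $x_i(t)=1$ and $C_i=0$. Else, if $\tau'=\mathrm{NULL}$ or there exists $\tau\in[t,\tau']$ with $a_i(\tau)>0$: set $x_i(t)=x_i(t-1)$ and replace $C_i$ by $C_i+p(t)d_t^i x_i(t)$. Else: set $x_i(t)=0$ and $C_i=0$. Algorithm $\mathbf{GCSR^{(w)}}$ for $\mathbf{CP}$: run $\mathbf{GCSR_s^{(w)}}$ on each $\mathbf{CP_i}$, $1\le i\le M$, obtaining $\boldsymbol{x}_i^{on}$, and output $\boldsymbol{x}^{on}=\sum_{i=1}^M\boldsymbol{x}_i^{on}$.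
   Formalization: Inputs are continued past T by w idle slots (truncating at T breaks the upper bound); at fixed d_min optimality is 2-α_s ≤ γ(1+d_min·P_min/β_s), else false; uniformly over d_min, 2-α_s cannot be lowered by any ε>0; optimality assumes P_max>0. -}

module Defs where

open import Level using (Level; _⊔_) renaming (suc to lsuc)
open import Algebra.Bundles using (CommutativeRing)
open import Algebra.Structures using (IsCommutativeRing)
import Algebra.Construct.NaturalChoice.Max as NaturalMax
import Algebra.Construct.NaturalChoice.Min as NaturalMin
import Algebra.Definitions.RawMonoid as RawMonoidDefs
open import Data.Bool.Base using (Bool; if_then_else_)
open import Data.Fin.Base using (toℕ)
open import Data.List.Base as List using (List; []; _∷_)
open import Data.List.Relation.Unary.Any using (any?)
open import Data.Maybe.Base as Maybe using (Maybe; just; nothing)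
import Data.Nat.ListAction as ListAction
open import Data.Nat.Base as ℕ using (ℕ; zero; suc; pred)
open import Data.Product.Base using (∃; _×_; _,_; proj₁; proj₂)
open import Data.Vec.Base as Vec using (Vec; []; _∷_)
open import Data.Vec.Relation.Binary.Pointwise.Inductive using (Pointwise)
open import Data.Vec.Relation.Unary.All using (All)
open import Relation.Binary.Bundles using (DecTotalOrder; TotalOrder)
open import Relation.Binary.Core using (Rel)
open import Relation.Binary.Definitions using (Decidable)
open import Relation.Binary.PropositionalEquality.Core using (_≡_; _≢_)
import Relation.Binary.Construct.NonStrictToStrict as Strict
open import Relation.Binary.Structures using (IsDecTotalOrder)
open import Relation.Nullary using (¬_)
open import Relation.Nullary.Decidable using (does; yes; no)

-- Real quantities are taken in an arbitrary Archimedean ordered field (ℝ and ℚ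
-- are the models in mind). Archimedes' axiom is what makes ⌈_⌉ available.

record ArchimedeanOrderedField (c ℓ : Level) : Set (lsuc (c ⊔ ℓ)) where
  infix  8 _⁻¹ -_
  infixl 7 _*_
  infixl 6 _+_
  infix  4 _≤_
  field
    Carrier           : Set c
    _≤_               : Rel Carrier ℓ
    _+_ _*_           : Carrier → Carrier → Carrier
    -_                : Carrier → Carrier
    0# 1#             : Carrier
    _⁻¹               : Carrier → Carrier
    isCommutativeRing : IsCommutativeRing _≡_ _+_ _*_ -_ 0# 1#
    isDecTotalOrder   : IsDecTotalOrder _≡_ _≤_
    0≢1               : 0# ≢ 1#
    *-inverseʳ        : ∀ x → x ≢ 0# → x * x ⁻¹ ≡ 1#
    +-monoˡ-≤         : ∀ z {x y} → x ≤ y → x + z ≤ y + z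
    *-nonNeg          : ∀ {x y} → 0# ≤ x → 0# ≤ y → 0# ≤ x * y

  commutativeRing : CommutativeRing c c
  commutativeRing = record { isCommutativeRing = isCommutativeRing }

  decTotalOrder : DecTotalOrder c c ℓ
  decTotalOrder = record { isDecTotalOrder = isDecTotalOrder }

  totalOrder : TotalOrder c c ℓ
  totalOrder = DecTotalOrder.totalOrder decTotalOrder

  open CommutativeRing commutativeRing public using (_-_; +-rawMonoid)
  open IsDecTotalOrder isDecTotalOrder public using (_≟_; _≤?_)
  open Strict _≡_ _≤_ public using (_<_)
  open RawMonoidDefs +-rawMonoid public using () renaming (_×_ to _·_)
  open NaturalMin totalOrder public using () renaming (_⊓_ to min)
  open NaturalMax totalOrder public using () renaming (_⊔_ to max)

  _<?_ : Decidable _<_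
  _<?_ = Strict.<-decidable _≡_ _≤_ _≟_ _≤?_

  ι : ℕ → Carrier
  ι n = n · 1#

  field
    archimedean : ∀ x → ∃ λ n → x ≤ ι n

  [_]⁺ : Carrier → Carrier
  [ z ]⁺ = max 0# z

  -- The least natural number ≥ x (hence 0 for negative x). The search starts
  -- at 0 and cannot go past the bound given by Archimedes' axiom.
  ⌈_⌉ : Carrier → ℕ
  ⌈ x ⌉ = search (proj₁ (archimedean x)) 0
    where
    search : (fuel candidate : ℕ) → ℕ
    search zero       k = k
    search (suc fuel) k = if does (x ≤? ι k) then k else search fuel (suc k)


module Provisioning {c ℓ} (F : ArchimedeanOrderedField c ℓ) where

  open ArchimedeanOrderedField F

  -- Workload, grid price and power consumption function of one time slot.
  record Slot : Set c where
    constructor slot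
    field
      a : Carrier
      p : Carrier
      g : ℕ → Carrier → Carrier

    d : ℕ → Carrier
    d x = g x a

    -- These are a_i(t) and d_t^i; the index i is meant to be ≥ 1.
    aᵢ : ℕ → Carrier
    aᵢ i = min 1# (max 0# (a - ι (pred i)))

    dᵢ : ℕ → Carrier
    dᵢ i = d i - d (pred i)

  open Slot public

  -- Monotonicity and convexity are required in each of x and a separately.
  record Valid (Pmin Pmax : Carrier) (s : Slot) : Set (c ⊔ ℓ) where
    field
      a-nonNeg   : 0# ≤ a s
      p-lower    : Pmin ≤ p s
      p-upper    : p s ≤ Pmax
      g-nonNeg   : ∀ x {b} → 0# ≤ b → 0# ≤ g s x b
      g-mono-x   : ∀ x {b} → 0# ≤ b → g s x b ≤ g s (suc x) b
      g-mono-a   : ∀ x {b b′} → 0# ≤ b → b ≤ b′ → g s x b ≤ g s x b′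
      g-convex-x : ∀ x {b} → 0# ≤ b →
                   g s (suc x) b - g s x b ≤ g s (suc (suc x)) b - g s (suc x) b
      g-convex-a : ∀ x {b b′ λ′} → 0# ≤ b → 0# ≤ b′ → 0# ≤ λ′ → λ′ ≤ 1# →
                   g s x (λ′ * b + (1# - λ′) * b′)
                     ≤ λ′ * g s x b + (1# - λ′) * g s x b′

  maxLoad : List Slot → ℕ
  maxLoad ss = List.foldr ℕ._⊔_ 0 (List.map (λ s → ⌈ a s ⌉) ss)

  dMin : ∀ {n} → Vec Slot (suc n) → Carrier
  dMin ss = Vec.foldr₁ min (Vec.map (λ s → d s 1 - d s 0) ss)

  αₛ : (w : ℕ) (δ Pmin β : Carrier) → Carrier
  αₛ w δ Pmin β = min 1# (ι w * δ * Pmin * β ⁻¹)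

  -- CP and CPᵢ differ only in the running cost of a slot and in the values
  -- allowed for the decision variable.
  record Problem : Set (c ⊔ lsuc ℓ) where
    field
      running    : Slot → ℕ → Carrier
      Admissible : Slot → ℕ → Set ℓ

  open Problem public

  CP : Problem
  CP = record
    { running    = λ s x → p s * d s x
    ; Admissible = λ s x → a s ≤ ι x
    }

  CPᵢ : ℕ → Problem
  CPᵢ i = record
    { running    = λ s x → p s * dᵢ s i * ι x
    ; Admissible = λ s x → x ℕ.≤ 1 × aᵢ s i ≤ ι x
    }

  -- costFrom x₀ has x₀ servers on just before the first slot of the vector.
  costFrom : ℕ → Carrier → Problem → ∀ {n} → Vec Slot n → Vec ℕ n → Carrier
  costFrom x₀ β P []       []       = 0#
  costFrom x₀ β P (s ∷ ss) (x ∷ xs) =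
    (running P s x + β * [ ι x - ι x₀ ]⁺) + costFrom x β P ss xs

  cost : Carrier → Problem → ∀ {n} → Vec Slot n → Vec ℕ n → Carrier
  cost = costFrom 0

  Feasible : Problem → ∀ {n} → Vec Slot n → Vec ℕ n → Set (c ⊔ ℓ)
  Feasible P = Pointwise (Admissible P)

  Optimal : Carrier → Problem → ∀ {n} → Vec Slot n → Vec ℕ n → Set (c ⊔ ℓ)
  Optimal β P ss y = Feasible P ss y × (∀ z → Feasible P ss z → cost β P ss y ≤ cost β P ss z)

  -- A deterministic online algorithm maps the time t = 1, 2, … and the slots
  -- revealed by then to the decision for slot t. With look-ahead w the slots
  -- 1, …, min(t + w, T) are revealed; T itself is not.
  Online : Set c
  Online = ℕ → List Slot → ℕ

  run : ℕ → Online → ∀ {n} → Vec Slot n → Vec ℕ n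
  run w A ss = Vec.tabulate λ k →
    A (suc (toℕ k)) (List.take (suc (toℕ k) ℕ.+ w) (Vec.toList ss))

  InputClass : Set (lsuc (c ⊔ ℓ))
  InputClass = ∀ {n} → Vec Slot (suc n) → Set (c ⊔ ℓ)

  Competitive : Carrier → Problem → InputClass → ℕ → Online → Carrier → Set (c ⊔ ℓ)
  Competitive β P Class w A γ =
    ∀ {n} (ss : Vec Slot (suc n)) → Class ss →
    Feasible P ss (run w A ss) ×
    (∀ y → Optimal β P ss y → cost β P ss (run w A ss) ≤ γ * cost β P ss y)

  Inputs : (Pmin Pmax δ : Carrier) → InputClass
  Inputs Pmin Pmax δ ss = All (Valid Pmin Pmax) ss × dMin ss ≡ δ

  Inputsᵢ : (i : ℕ) (Pmin Pmax δ : Carrier) → InputClass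
  Inputsᵢ i Pmin Pmax δ ss = Inputs Pmin Pmax δ ss × i ℕ.≤ maxLoad (Vec.toList ss)

  -- A possible slot after the horizon: no workload, and the same lower bounds
  -- on price and power as within the horizon.
  record Idle (Pmin Pmax δ : Carrier) (s : Slot) : Set (c ⊔ ℓ) where
    field
      valid      : Valid Pmin Pmax s
      noWorkload : a s ≡ 0#
      δ≤d        : δ ≤ d s 1 - d s 0

  -- The look-ahead interval [t, t + w] reaches past T when t > T - w, and the
  -- algorithm needs slots T + 1, …, T + w there: these are `tail`. They do not
  -- contribute to the cost. Leaving them out (so that the sum defining τ′ stops
  -- at T) would keep an idle server on until T for lack of future running cost,
  -- and the ratio 2 - αₛ would fail.
  module GCSR {w : ℕ} (tail : Vec Slot w) (β : Carrier) where

    module _ (i : ℕ) where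

      record State : Set c where
        constructor ⟨_,_⟩
        field
          C : Carrier
          x : ℕ

      -- The slots t, …, τ′ of a window starting at t; nothing if τ′ = NULL.
      upToτ′ : Carrier → List Slot → Maybe (List Slot)
      upToτ′ C []       = nothing
      upToτ′ C (s ∷ ss) with β ≤? C + p s * dᵢ s i
      ... | yes _ = just (s ∷ [])
      ... | no  _ = Maybe.map (s ∷_) (upToτ′ (C + p s * dᵢ s i) ss)

      busy : List Slot → Bool
      busy ss = does (any? (λ s → 0# <? aᵢ s i) ss)

      -- One time step, given the slots t, …, t + w.
      step : State → List Slot → State
      step st        []           = st
      step ⟨ C , x ⟩ (s ∷ window) =
        if busy (s ∷ []) then ⟨ 0# , 1 ⟩ else decide (upToτ′ C (s ∷ window))
        where
        keep : State
        keep = ⟨ C + p s * dᵢ s i * ι x , x ⟩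

        decide : Maybe (List Slot) → State
        decide nothing   = keep
        decide (just ss) = if busy ss then keep else ⟨ 0# , 0 ⟩

      steps : ℕ → State → List Slot → State
      steps zero    st ss = st
      steps (suc t) st ss =
        steps t (step st (List.take (suc w) (ss List.++ Vec.toList tail))) (List.drop 1 ss)

      server : Online
      server t revealed = State.x (steps t ⟨ 0# , 0 ⟩ revealed)

    -- The number M of servers is replaced by its value on the revealed slots:
    -- a server above that index has had no workload so far, so it is off.
    total : Online
    total t revealed =
      ListAction.sum (List.map (λ i → server (suc i) t revealed) (List.upTo (maxLoad revealed)))

  GCSRₛ : ∀ {w} → Vec Slot w → Carrier → ℕ → Online
  GCSRₛ tail β i = GCSR.server tail β i

  GCSR : ∀ {w} → Vec Slot w → Carrier → Online
  GCSR tail β = GCSR.total tail β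


  record Parameters : Set (c ⊔ ℓ) where
    field
      β Pmin Pmax : Carrier
      0<β         : 0# < β
      0≤Pmin      : 0# ≤ Pmin
      Pmin≤Pmax   : Pmin ≤ Pmax

  -- Here w is the window size and δ the value of d_min.
  module _ (w : ℕ) (π : Parameters) where

    open Parameters π

    α : Carrier → Carrier
    α δ = αₛ w δ Pmin β

    2-α : Carrier → Carrier
    2-α δ = (1# + 1#) - α δ

    CompetitiveForCPᵢ : (δ : Carrier) → ℕ → Online → Carrier → Set (c ⊔ ℓ)
    CompetitiveForCPᵢ δ i = Competitive β (CPᵢ i) (Inputsᵢ i Pmin Pmax δ) w

    CompetitiveForCP : (δ : Carrier) → Online → Carrier → Set (c ⊔ ℓ)
    CompetitiveForCP δ = Competitive β CP (Inputs Pmin Pmax δ) w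

    α-Normalised : Set (c ⊔ ℓ)
    α-Normalised = ∀ δ → 0# ≤ δ → 0# ≤ α δ × α δ ≤ 1#

    GCSRₛ-Achieves-2-α : Set (c ⊔ ℓ)
    GCSRₛ-Achieves-2-α =
      ∀ δ (tail : Vec Slot w) → All (Idle Pmin Pmax δ) tail →
      ∀ i → 1 ℕ.≤ i → CompetitiveForCPᵢ δ i (GCSRₛ tail β i) (2-α δ)

    GCSR-Achieves-2-α : Set (c ⊔ ℓ)
    GCSR-Achieves-2-α =
      ∀ δ (tail : Vec Slot w) → All (Idle Pmin Pmax δ) tail →
      CompetitiveForCP δ (GCSR tail β) (2-α δ)

    -- `CompetitiveFor δ A γ` stands for competitiveness in CP or in some CPᵢ.
    -- When Pmax = 0 electricity is free and never switching off is optimal,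
    -- so that case is left out.

    -- The guarantee 2 - αₛ, a function of the input through δ, cannot be
    -- lowered by any ε > 0.
    2-α-Optimal : (Carrier → Online → Carrier → Set (c ⊔ ℓ)) → Set (c ⊔ ℓ)
    2-α-Optimal CompetitiveFor =
      0# < Pmax → ∀ A ε → 0# < ε →
      ¬ (∀ δ → 0# ≤ δ → CompetitiveFor δ A (2-α δ - ε))

    -- For one fixed δ the ratio 2 - αₛ is optimal only in the limit of short
    -- slots: every slot with workload costs at least δ * Pmin, which any
    -- solution has to pay. Hence the factor 1 + δ * Pmin / β.
    2-α-OptimalAtFixed-δ : (Carrier → Online → Carrier → Set (c ⊔ ℓ)) → Set (c ⊔ ℓ)
    2-α-OptimalAtFixed-δ CompetitiveFor =
      0# < Pmax → ∀ A δ γ → 0# ≤ δ → CompetitiveFor δ A γ →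
      2-α δ ≤ γ * (1# + δ * Pmin * β ⁻¹)

{-# OPTIONS --safe #-}

-- Upper bound for CPᵢ: a gap between two slots with workload is short if it ends
-- before its idling cost reaches β. In a short gap the algorithm stays on and pays
-- the idling cost, as an optimal solution does. In a long gap the window shows that
-- the gap is long once w slots before the idling cost reaches β, so at most
-- (1 - α)β is wasted before the server is switched off, where an optimal solution
-- pays β. A potential function makes the comparison slot by slot, with an arbitrary
-- feasible solution. For CP, convexity makes the sum of the servers' solutions at
-- most as expensive as the costs in the CPᵢ together, whereas a solution of CP
-- splits into solutions of the CPᵢ without loss.
--
-- Lower bound: after each slot with workload the adversary presents slots without
-- workload, each with idling cost e, until the algorithm switches off, and lets the
-- workload return as soon as the look-ahead permits. If the server is on for k slots
-- of the gap, the round costs β + (k + 1)e online and e + min(β, (k + 1 + w)e)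
-- offline. The quotient is at least (2β - min(β, we)) / (β + e), and e may be chosen
-- as δ Pmin or arbitrarily close to it.

module Submission where

open import Defs
open import Algebra.Bundles using (CommutativeRing)
import Algebra.Construct.NaturalChoice.Max as NaturalMax
import Algebra.Construct.NaturalChoice.Min as NaturalMin
import Algebra.Properties.Monoid.Mult as MonoidMult
import Algebra.Properties.Ring as RingProperties
import Algebra.Properties.Semiring.Mult as SemiringMult
import Algebra.Solver.Ring as RingSolver
open import Algebra.Solver.Ring.AlmostCommutativeRing
  using (fromCommutativeRing; _-Raw-AlmostCommutative⟶_)
open import Data.Bool.Base using (if_then_else_; true; false)
open import Data.Fin.Base using (Fin; zero; suc; toℕ)
open import Data.Integer.Base as ℤ using (ℤ; -[1+_]; _◃_) renaming (+_ to pos)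
import Data.Integer.Properties as ℤₚ
open import Data.List.Base as List using (List; []; _∷_; _++_; take; drop; length)
open import Data.List.Properties
  using (length-take; length-++; length-replicate; ++-assoc; ∷ʳ-++; map-++; upTo-∷ʳ)
import Data.List.Relation.Unary.All as ListAll
open import Data.List.Relation.Unary.All.Properties using (take⁺; ++⁺)
open import Data.List.Relation.Unary.Any using (Any; here; there; any?)
open import Data.Maybe.Base as Maybe using (Maybe; just; nothing)
open import Data.Nat.Base as ℕ using (ℕ; zero; suc; z≤n; s≤s)
open import Data.Nat.ListAction using (sum)
open import Data.Nat.ListAction.Properties using (sum-++)
import Data.Nat.Properties as ℕₚ
open import Data.Product.Base using (∃; _×_; _,_; proj₁; proj₂)
import Data.Sign.Base as Sign
open import Data.Sum.Base as Sum using (_⊎_; inj₁; inj₂; reduce)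
open import Data.Vec.Base as Vec using (Vec; []; _∷_; toList; tabulate)
open import Data.Vec.Properties using (tabulate-cong; tabulate-∘; map-const; length-toList)
open import Data.Vec.Relation.Binary.Pointwise.Inductive using (Pointwise; []; _∷_)
import Data.Vec.Relation.Unary.All as VecAll
open import Data.Vec.Relation.Unary.All.Properties as VecAllₚ using (toList⁺; toList⁻)
open import Function.Base using (_∘_)
import Level
open import Relation.Binary.PropositionalEquality
  using (_≡_; _≢_; refl; sym; trans; cong; cong₂; subst; subst₂; module ≡-Reasoning)
open import Relation.Binary.Structures using (IsDecTotalOrder)
open import Relation.Nullary using (¬_; Dec; yes; no; does; contradiction)
open import Relation.Nullary.Decidable using (dec⇒maybe; dec-true; dec-false)

-- In the potential argument, κβ with κ = 1 - α is a reserve. When both sides switch on, γβ = β + κβ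
-- pays for the algorithm's switch-on and fills the reserve, which then pays for idling before a
-- switch-off. While both idle, the factor γ leaves κ times the common cost. After the algorithm has
-- switched off, C keeps counting the competitor's idling, because only the cost of the entire gap
-- is known to reach β. In a short gap C may exceed κβ; then κβ - C is negative, which is harmless
-- since the competitor must come back and C ≤ β. For the lower bound, the input cannot be fixed in
-- advance: whether a gap goes on depends on answers that the algorithm gives with w further slots
-- in view. The adversary queries it on a prefix followed by w + 1 idle slots and has to deliver all
-- of these later, whatever the answer. A credit φ = β for a server that is on lets each round be
-- accounted for separately. Finally, competitiveness bounds the cost only against optimal
-- solutions, so an optimum has to be constructed before the hypothesis yields any bound.

module OrderedField {c ℓ} (F : ArchimedeanOrderedField c ℓ) where

  open ArchimedeanOrderedField F public
  open CommutativeRing commutativeRing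
    using (ring; semiring; *-assoc; +-monoid; +-identityˡ; *-identityʳ; -‿inverseʳ)
  open CommutativeRing commutativeRing public using (+-identityʳ)
  open RingProperties ring using (-‿involutive; -‿distribˡ-*; -‿distribʳ-*; -0#≈0#; -‿+-comm)
  open IsDecTotalOrder isDecTotalOrder public
    using (total; antisym)
    renaming (refl to ≤-refl; trans to ≤-trans; reflexive to ≤-reflexive)

  -- Naturals and integers in the field, as coefficients of the ring solver

  ι-+ : ∀ m n → ι (m ℕ.+ n) ≡ ι m + ι n
  ι-+ = MonoidMult.×-homo-+ +-monoid 1#

  ι-* : ∀ m n → ι (m ℕ.* n) ≡ ι m * ι n
  ι-* = SemiringMult.×1-homo-* semiring

  ι1 : ι 1 ≡ 1#
  ι1 = +-identityʳ 1#

  fromℤ : ℤ → Carrier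
  fromℤ (pos n)  = ι n
  fromℤ -[1+ n ] = - ι (suc n)

  private
    +-cancel-suc : ∀ x y → x - y ≡ (1# + x) - (1# + y)
    +-cancel-suc x y = sym (begin
      (1# + x) + - (1# + y)       ≡⟨ cong₂ _+_ (R.+-comm 1# x) (sym (-‿+-comm 1# y)) ⟩
      (x + 1#) + (- 1# + - y)     ≡⟨ R.+-assoc x 1# _ ⟩
      x + (1# + (- 1# + - y))     ≡⟨ cong (x +_) (sym (R.+-assoc 1# (- 1#) (- y))) ⟩
      x + ((1# + - 1#) + - y)     ≡⟨ cong (λ z → x + (z + - y)) (-‿inverseʳ 1#) ⟩
      x + (0# + - y)              ≡⟨ cong (x +_) (+-identityˡ (- y)) ⟩
      x + - y                     ∎)
      where
      open ≡-Reasoning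
      module R = CommutativeRing commutativeRing

    fromℤ-⊖ : ∀ m n → fromℤ (m ℤ.⊖ n) ≡ ι m - ι n
    fromℤ-⊖ m       zero    = sym (trans (cong (ι m +_) -0#≈0#) (+-identityʳ (ι m)))
    fromℤ-⊖ zero    (suc n) = sym (+-identityˡ _)
    fromℤ-⊖ (suc m) (suc n) =
      trans (cong fromℤ (ℤₚ.[1+m]⊖[1+n]≡m⊖n m n))
            (trans (fromℤ-⊖ m n) (+-cancel-suc (ι m) (ι n)))

    fromℤ-+◃ : ∀ n → fromℤ (Sign.+ ◃ n) ≡ ι n
    fromℤ-+◃ zero    = refl
    fromℤ-+◃ (suc n) = refl

    fromℤ--◃ : ∀ n → fromℤ (Sign.- ◃ n) ≡ - ι n
    fromℤ--◃ zero    = sym -0#≈0#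
    fromℤ--◃ (suc n) = refl

    fromℤ-neg : ∀ i → fromℤ (ℤ.- i) ≡ - fromℤ i
    fromℤ-neg (pos zero)    = sym -0#≈0#
    fromℤ-neg (pos (suc n)) = refl
    fromℤ-neg -[1+ n ]      = sym (-‿involutive _)

    fromℤ-+ : ∀ i j → fromℤ (i ℤ.+ j) ≡ fromℤ i + fromℤ j
    fromℤ-+ (pos m)  (pos n)  = ι-+ m n
    fromℤ-+ (pos m)  -[1+ n ] = fromℤ-⊖ m (suc n)
    fromℤ-+ -[1+ m ] (pos n)  =
      trans (fromℤ-⊖ n (suc m)) (CommutativeRing.+-comm commutativeRing _ _)
    fromℤ-+ -[1+ m ] -[1+ n ] =
      trans (cong (λ k → - ι (suc k)) (sym (ℕₚ.+-suc m n)))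
            (trans (cong -_ (ι-+ (suc m) (suc n))) (sym (-‿+-comm _ _)))

    fromℤ-* : ∀ i j → fromℤ (i ℤ.* j) ≡ fromℤ i * fromℤ j
    fromℤ-* (pos m)  (pos n)  = trans (fromℤ-+◃ (m ℕ.* n)) (ι-* m n)
    fromℤ-* (pos m)  -[1+ n ] =
      trans (fromℤ--◃ (m ℕ.* suc n)) (trans (cong -_ (ι-* m (suc n))) (-‿distribʳ-* _ _))
    fromℤ-* -[1+ m ] (pos n)  =
      trans (fromℤ--◃ (suc m ℕ.* n)) (trans (cong -_ (ι-* (suc m) n)) (-‿distribˡ-* _ _))
    fromℤ-* -[1+ m ] -[1+ n ] =
      trans (fromℤ-+◃ (suc m ℕ.* suc n)) (trans (ι-* (suc m) (suc n))
        (trans (sym (-‿involutive _))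
          (trans (cong -_ (-‿distribˡ-* _ _)) (-‿distribʳ-* _ _))))

    -- Sends 1 to 1# itself rather than to ι 1 = 1# + 0#, so that the solver's
    -- constants denote 0# and 1# definitionally.
    coefficient : ℤ → Carrier
    coefficient (pos 1) = 1#
    coefficient i       = fromℤ i

    coefficient≡ : ∀ i → coefficient i ≡ fromℤ i
    coefficient≡ (pos 0)             = refl
    coefficient≡ (pos 1)             = sym ι1
    coefficient≡ (pos (suc (suc n))) = refl
    coefficient≡ -[1+ n ]            = refl

    coefficient-homo : ℤ.+-*-rawRing -Raw-AlmostCommutative⟶ fromCommutativeRing commutativeRing
    coefficient-homo = record
      { ⟦_⟧    = coefficient
      ; +-homo = λ i j → trans (coefficient≡ (i ℤ.+ j))
          (trans (fromℤ-+ i j) (sym (cong₂ _+_ (coefficient≡ i) (coefficient≡ j))))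
      ; *-homo = λ i j → trans (coefficient≡ (i ℤ.* j))
          (trans (fromℤ-* i j) (sym (cong₂ _*_ (coefficient≡ i) (coefficient≡ j))))
      ; -‿homo = λ i → trans (coefficient≡ (ℤ.- i))
          (trans (fromℤ-neg i) (sym (cong -_ (coefficient≡ i))))
      ; 0-homo = refl
      ; 1-homo = refl
      }

  -- Integer coefficients: the equality test on them computes, which the one
  -- on an abstract carrier does not.
  open RingSolver ℤ.+-*-rawRing (fromCommutativeRing commutativeRing) coefficient-homo
    (λ i j → Maybe.map (cong coefficient) (dec⇒maybe (i ℤₚ.≟ j)))
    public using (solve; _:=_; _:+_; _:*_; _:-_; :-_; con; Polynomial)

  :0 :1 : ∀ {n} → Polynomial n
  :0 = con (pos 0)
  :1 = con (pos 1)


  -- Inequalities, positive parts, inverses and the ceiling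

  x≤y⇒0≤y-x : ∀ {x y} → x ≤ y → 0# ≤ y - x
  x≤y⇒0≤y-x {x} {y} x≤y = subst (_≤ y - x) (-‿inverseʳ x) (+-monoˡ-≤ (- x) x≤y)

  -- Linear and polynomial inequalities are proved by exhibiting the difference
  -- of the two sides as a visibly nonnegative expression.
  ≤-by : ∀ {x y z} → 0# ≤ z → y ≡ x + z → x ≤ y
  ≤-by {x} 0≤z refl =
    subst₂ _≤_ (+-identityˡ x) (CommutativeRing.+-comm commutativeRing _ x) (+-monoˡ-≤ x 0≤z)

  infixl 6 _⊕_
  infixl 7 _⊛_

  _⊕_ : ∀ {x y} → 0# ≤ x → 0# ≤ y → 0# ≤ x + y
  0≤x ⊕ 0≤y = ≤-trans 0≤y (≤-by 0≤x (CommutativeRing.+-comm commutativeRing _ _))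

  _⊛_ : ∀ {x y} → 0# ≤ x → 0# ≤ y → 0# ≤ x * y
  _⊛_ = *-nonNeg

  ⟪_⟫ : ∀ {x y} → x ≤ y → 0# ≤ y - x
  ⟪_⟫ = x≤y⇒0≤y-x

  +-mono-≤ : ∀ {x y u v} → x ≤ y → u ≤ v → x + u ≤ y + v
  +-mono-≤ {x} {y} {u} {v} x≤y u≤v = ≤-by (⟪ x≤y ⟫ ⊕ ⟪ u≤v ⟫)
    (solve 4 (λ x y u v → y :+ v := x :+ u :+ (y :- x :+ (v :- u))) refl x y u v)

  +-monoʳ-≤ : ∀ z {x y} → x ≤ y → z + x ≤ z + y
  +-monoʳ-≤ z = +-mono-≤ ≤-refl

  *-monoˡ-≤-nonNeg : ∀ {z x y} → 0# ≤ z → x ≤ y → z * x ≤ z * y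
  *-monoˡ-≤-nonNeg {z} {x} {y} 0≤z x≤y = ≤-by (0≤z ⊛ ⟪ x≤y ⟫)
    (solve 3 (λ z x y → z :* y := z :* x :+ z :* (y :- x)) refl z x y)

  *-monoʳ-≤-nonNeg : ∀ {z x y} → 0# ≤ z → x ≤ y → x * z ≤ y * z
  *-monoʳ-≤-nonNeg {z} {x} {y} 0≤z x≤y = ≤-by (⟪ x≤y ⟫ ⊛ 0≤z)
    (solve 3 (λ z x y → y :* z := x :* z :+ (y :- x) :* z) refl z x y)

  ≰⇒≥ : ∀ {x y} → ¬ x ≤ y → y ≤ x
  ≰⇒≥ {x} {y} x≰y with total x y
  ... | inj₁ x≤y = contradiction x≤y x≰y
  ... | inj₂ y≤x = y≤x

  ≰⇒> : ∀ {x y} → ¬ x ≤ y → y < x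
  ≰⇒> x≰y = ≰⇒≥ x≰y , λ { refl → x≰y ≤-refl }

  <⇒≱ : ∀ {x y} → x < y → ¬ y ≤ x
  <⇒≱ (x≤y , x≢y) y≤x = x≢y (antisym x≤y y≤x)

  x<y⇒0<y-x : ∀ {x y} → x < y → 0# < y - x
  x<y⇒0<y-x {x} {y} x<y@(x≤y , _) = ⟪ x≤y ⟫ , λ 0≡y-x → <⇒≱ x<y (≤-by ≤-refl
    (trans (solve 2 (λ x y → x := y :- (y :- x)) refl x y)
      (trans (cong (λ z → y - z) (sym 0≡y-x)) (solve 1 (λ y → y :- :0 := y :+ :0) refl y))))

  0≤1 : 0# ≤ 1#
  0≤1 with total 0# 1#
  ... | inj₁ 0≤1 = 0≤1
  ... | inj₂ 1≤0 = ≤-by (⟪ 1≤0 ⟫ ⊛ ⟪ 1≤0 ⟫)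
    (solve 0 (:1 := :0 :+ (:0 :- :1) :* (:0 :- :1)) refl)

  1≰0 : ¬ 1# ≤ 0#
  1≰0 1≤0 = 0≢1 (antisym 0≤1 1≤0)

  ι-nonNeg : ∀ n → 0# ≤ ι n
  ι-nonNeg zero    = ≤-refl
  ι-nonNeg (suc n) = 0≤1 ⊕ ι-nonNeg n

  ι-mono : ∀ {m n} → m ℕ.≤ n → ι m ≤ ι n
  ι-mono {n = n} z≤n = ι-nonNeg n
  ι-mono (s≤s m≤n)   = +-monoʳ-≤ 1# (ι-mono m≤n)

  ι-suc≰ : ∀ n → ¬ ι (suc n) ≤ ι n
  ι-suc≰ n 1+n≤n = 1≰0 (≤-by ⟪ 1+n≤n ⟫
    (solve 1 (λ n → :0 := :1 :+ (n :- (:1 :+ n))) refl (ι n)))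

  ι-cancel-≤ : ∀ {m n} → ι m ≤ ι n → m ℕ.≤ n
  ι-cancel-≤ {m} {n} ιm≤ιn with m ℕₚ.≤? n
  ... | yes m≤n = m≤n
  ... | no  m≰n = contradiction (≤-trans (ι-mono {suc n} {m} (ℕₚ.≰⇒> m≰n)) ιm≤ιn) (ι-suc≰ n)

  open NaturalMax totalOrder public using ()
    renaming (x≤x⊔y to x≤max; x≤y⊔x to y≤max; ⊔-lub to max-lub)
  open NaturalMin totalOrder public using ()
    renaming (x⊓y≤x to min≤x; x⊓y≤y to min≤y; ⊓-glb to min-glb; ⊓-sel to min-sel)

  0≤[_]⁺ : ∀ z → 0# ≤ [ z ]⁺
  0≤[ z ]⁺ = x≤max 0# z

  ≤[_]⁺ : ∀ z → z ≤ [ z ]⁺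
  ≤[ z ]⁺ = y≤max 0# z

  []⁺-lub : ∀ {z c} → 0# ≤ c → z ≤ c → [ z ]⁺ ≤ c
  []⁺-lub = max-lub

  []⁺-mono : ∀ {y z} → y ≤ z → [ y ]⁺ ≤ [ z ]⁺
  []⁺-mono {y} {z} y≤z = []⁺-lub 0≤[ z ]⁺ (≤-trans y≤z ≤[ z ]⁺)

  z≤0⇒[z]⁺≡0 : ∀ {z} → z ≤ 0# → [ z ]⁺ ≡ 0#
  z≤0⇒[z]⁺≡0 z≤0 = antisym ([]⁺-lub ≤-refl z≤0) 0≤[ _ ]⁺

  0≤z⇒[z]⁺≡z : ∀ {z} → 0# ≤ z → [ z ]⁺ ≡ z
  0≤z⇒[z]⁺≡z 0≤z = antisym ([]⁺-lub 0≤z ≤-refl) ≤[ _ ]⁺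

  ι-decrease : ∀ {x y} → x ℕ.≤ y → [ ι x - ι y ]⁺ ≡ 0#
  ι-decrease {x} {y} x≤y = z≤0⇒[z]⁺≡0 (≤-by ⟪ ι-mono x≤y ⟫
    (solve 2 (λ x y → :0 := x :- y :+ (y :- x)) refl (ι x) (ι y)))

  ι-increase : ∀ {x y} → x ℕ.≤ y → [ ι y - ι x ]⁺ ≡ ι y - ι x
  ι-increase x≤y = 0≤z⇒[z]⁺≡z ⟪ ι-mono x≤y ⟫

  []⁺-subadditive : ∀ y z → [ y + z ]⁺ ≤ [ y ]⁺ + [ z ]⁺
  []⁺-subadditive y z = []⁺-lub (0≤[ y ]⁺ ⊕ 0≤[ z ]⁺) (+-mono-≤ ≤[ y ]⁺ ≤[ z ]⁺)

  0<⇒≢0 : ∀ {x} → 0# < x → x ≢ 0#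
  0<⇒≢0 (_ , 0≢x) x≡0 = 0≢x (sym x≡0)

  ⁻¹-inverse : ∀ {x} → 0# < x → x * x ⁻¹ ≡ 1#
  ⁻¹-inverse 0<x = *-inverseʳ _ (0<⇒≢0 0<x)

  ⁻¹-nonNeg : ∀ {x} → 0# < x → 0# ≤ x ⁻¹
  ⁻¹-nonNeg {x} 0<x with total 0# (x ⁻¹)
  ... | inj₁ 0≤x⁻¹ = 0≤x⁻¹
  ... | inj₂ x⁻¹≤0 = contradiction
    (subst (_≤ 0#) (⁻¹-inverse 0<x) (≤-by (proj₁ 0<x ⊛ ⟪ x⁻¹≤0 ⟫)
      (solve 2 (λ x y → :0 := x :* y :+ x :* (:0 :- y)) refl x (x ⁻¹))))
    1≰0

  x*y*y⁻¹≡x : ∀ x {y} → 0# < y → x * y * y ⁻¹ ≡ x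
  x*y*y⁻¹≡x x {y} 0<y =
    trans (*-assoc x y (y ⁻¹)) (trans (cong (x *_) (⁻¹-inverse 0<y)) (*-identityʳ x))

  x*y⁻¹*y≡x : ∀ x {y} → 0# < y → x * y ⁻¹ * y ≡ x
  x*y⁻¹*y≡x x {y} 0<y =
    trans (solve 3 (λ x y z → x :* z :* y := x :* y :* z) refl x y (y ⁻¹)) (x*y*y⁻¹≡x x 0<y)

  *-cancelʳ-≤-pos : ∀ {x y z} → 0# < z → x * z ≤ y * z → x ≤ y
  *-cancelʳ-≤-pos {x} {y} {z} 0<z xz≤yz =
    subst₂ _≤_ (x*y*y⁻¹≡x x 0<z) (x*y*y⁻¹≡x y 0<z)
      (≤-by (⟪ xz≤yz ⟫ ⊛ ⁻¹-nonNeg 0<z)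
        (solve 4 (λ x y z u → y :* z :* u := x :* z :* u :+ (y :* z :- x :* z) :* u)
          refl x y z (z ⁻¹)))

  *-pos : ∀ {x y} → 0# < x → 0# < y → 0# < x * y
  *-pos {x} {y} 0<x 0<y = proj₁ 0<x ⊛ proj₁ 0<y , λ 0≡xy →
    0<⇒≢0 0<x (trans (sym (x*y*y⁻¹≡x x 0<y)) (trans (cong (_* y ⁻¹) (sym 0≡xy))
      (solve 1 (λ u → :0 :* u := :0) refl (y ⁻¹))))

  ⁻¹-pos : ∀ {x} → 0# < x → 0# < x ⁻¹
  ⁻¹-pos {x} 0<x = ⁻¹-nonNeg 0<x , λ 0≡x⁻¹ → 0≢1
    (trans (solve 1 (λ x → :0 := x :* :0) refl x)
      (trans (cong (x *_) 0≡x⁻¹) (⁻¹-inverse 0<x)))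

  multiples-unbounded : ∀ {x y} → 0# < x → ¬ (∀ n → ι n * x ≤ y)
  multiples-unbounded {x} {y} 0<x bounded with archimedean (y * x ⁻¹)
  ... | n , y/x≤n = ι-suc≰ n (≤-trans
    (*-cancelʳ-≤-pos 0<x (subst (ι (suc n) * x ≤_) (sym (x*y⁻¹*y≡x y 0<x)) (bounded (suc n))))
    y/x≤n)

  -- If x exceeded y, then e = (x - y) / (1 + k) would be a counterexample.
  ≤-limit : ∀ {x y k} → 0# ≤ k → (∀ {e} → 0# < e → x ≤ y + k * e) → x ≤ y
  ≤-limit {x} {y} {k} 0≤k x≤y+ke with x ≤? y
  ... | yes x≤y = x≤y
  ... | no  x≰y = contradiction (*-nonNeg⁻¹ e≤0) (λ e≤0 → <⇒≱ 0<e e≤0)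
    where
    0<1+k : 0# < 1# + k
    0<1+k = 0≤1 ⊕ 0≤k , λ 0≡1+k → 1≰0 (≤-by 0≤k 0≡1+k)
    e = (x - y) * (1# + k) ⁻¹
    0<e : 0# < e
    0<e = *-pos (x<y⇒0<y-x (≰⇒> x≰y)) (⁻¹-pos 0<1+k)
    e≤0 : x - y - k * e ≤ 0#
    e≤0 = ≤-by ⟪ x≤y+ke 0<e ⟫
      (solve 4 (λ x y k e → :0 := x :- y :- k :* e :+ (y :+ k :* e :- x)) refl x y k e)
    *-nonNeg⁻¹ : x - y - k * e ≤ 0# → e ≤ 0#
    *-nonNeg⁻¹ = subst (_≤ 0#)
      (trans (cong (λ z → z - k * e) (sym (x*y⁻¹*y≡x (x - y) 0<1+k)))
        (solve 2 (λ e k → e :* (:1 :+ k) :- k :* e := e) refl e k))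

  -- The search inside ⌈_⌉ has no name here; `s` stands for it.
  private
    search-sound : ∀ x (s : ℕ → ℕ → ℕ) → (∀ k → s zero k ≡ k) →
      (∀ n k → s (suc n) k ≡ (if does (x ≤? ι k) then k else s n (suc k))) →
      ∀ n k → x ≤ ι (n ℕ.+ k) → ∃ λ j → s n k ≡ j × x ≤ ι j
    search-sound x s s₀ s₊ zero    k x≤n+k = k , s₀ k , x≤n+k
    search-sound x s s₀ s₊ (suc n) k x≤n+k with x ≤? ι k | s₊ n k
    ... | yes x≤k | eq = k , eq , x≤k
    ... | no  _   | eq
      with j , eq′ , x≤j ← search-sound x s s₀ s₊ n (suc k)
             (subst (λ j → x ≤ ι j) (sym (ℕₚ.+-suc n k)) x≤n+k)
      = j , trans eq eq′ , x≤j

    ⌈⌉-sound : ∀ x → ∃ λ j → ⌈ x ⌉ ≡ j × x ≤ ι j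
    ⌈⌉-sound x
      -- Fuel and candidate are generalised to variables, so that the unnamed search can be inferred
      -- from the goal by pattern unification.
      with search-sound x _ (λ _ → refl) (λ _ _ → refl) | proj₁ (archimedean x) | 0
         | subst (λ j → x ≤ ι j) (sym (ℕₚ.+-identityʳ (proj₁ (archimedean x)))) (proj₂ (archimedean x))
    ... | sound | n | k | x≤n+k = sound n k x≤n+k

  x≤⌈x⌉ : ∀ x → x ≤ ι ⌈ x ⌉
  x≤⌈x⌉ x with _ , refl , x≤j ← ⌈⌉-sound x = x≤j

-- Workload and power of a single slot

module SlotProperties {c ℓ} (F : ArchimedeanOrderedField c ℓ) where

  open OrderedField F
  open Provisioning F

  aᵢ≤1 : ∀ s i → aᵢ s i ≤ 1#
  aᵢ≤1 s i = min≤x 1# _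

  a≤i⇒aᵢ≤0 : ∀ s i → a s ≤ ι i → aᵢ s (suc i) ≤ 0#
  a≤i⇒aᵢ≤0 s i a≤i = ≤-trans (min≤y 1# _) (max-lub ≤-refl (≤-by ⟪ a≤i ⟫
    (solve 2 (λ a i → :0 := a :- i :+ (i :- a)) refl (a s) (ι i))))

  aᵢ≤0⇒a≤i : ∀ s i → aᵢ s (suc i) ≤ 0# → a s ≤ ι i
  aᵢ≤0⇒a≤i s i aᵢ≤0 with min-sel 1# (max 0# (a s - ι i))
  ... | inj₁ eq = contradiction (subst (_≤ 0#) eq aᵢ≤0) 1≰0
  ... | inj₂ eq = ≤-by ⟪ ≤-trans (y≤max 0# _) (subst (_≤ 0#) eq aᵢ≤0) ⟫
    (solve 2 (λ a i → i := a :+ (:0 :- (a :- i))) refl (a s) (ι i))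

  module _ {Pmin Pmax} {s : Slot} (valid : Valid Pmin Pmax s) where

    open Valid valid

    d-nonNeg : ∀ x → 0# ≤ d s x
    d-nonNeg x = g-nonNeg x a-nonNeg

    d-mono : ∀ {x y} → x ℕ.≤ y → d s x ≤ d s y
    d-mono {x} x≤y = go (ℕₚ.≤⇒≤′ x≤y)
      where
      go : ∀ {y} → x ℕ.≤′ y → d s x ≤ d s y
      go ℕ.≤′-refl        = ≤-refl
      go (ℕ.≤′-step x≤′y) = ≤-trans (go x≤′y) (g-mono-x _ a-nonNeg)

    -- By convexity `dMin`, which looks at the first server only, bounds the idling power of every
    -- server from below.
    d₁≤dᵢ : ∀ i → d s 1 - d s 0 ≤ dᵢ s (suc i)
    d₁≤dᵢ zero    = ≤-refl
    d₁≤dᵢ (suc i) = ≤-trans (d₁≤dᵢ i) (g-convex-x i a-nonNeg)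

    dᵢ-mono : ∀ {i j} → i ℕ.≤ j → dᵢ s (suc i) ≤ dᵢ s (suc j)
    dᵢ-mono {i} i≤j = go (ℕₚ.≤⇒≤′ i≤j)
      where
      go : ∀ {j} → i ℕ.≤′ j → dᵢ s (suc i) ≤ dᵢ s (suc j)
      go ℕ.≤′-refl        = ≤-refl
      go (ℕ.≤′-step i≤′j) = ≤-trans (go i≤′j) (g-convex-x _ a-nonNeg)

  dMin≤ : ∀ {n} (ss : Vec Slot (suc n)) → VecAll.All (λ s → dMin ss ≤ d s 1 - d s 0) ss
  dMin≤ (s ∷ [])      = ≤-refl VecAll.∷ VecAll.[]
  dMin≤ (s ∷ ss@(_ ∷ _)) = min≤x _ _ VecAll.∷ VecAll.map (≤-trans (min≤y _ _)) (dMin≤ ss)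

  dMin-glb : ∀ {x n} (ss : Vec Slot (suc n)) → VecAll.All (λ s → x ≤ d s 1 - d s 0) ss → x ≤ dMin ss
  dMin-glb (_ ∷ [])     (x≤ VecAll.∷ _)   = x≤
  dMin-glb (_ ∷ s ∷ ss) (x≤ VecAll.∷ x≤s) = min-glb x≤ (dMin-glb (s ∷ ss) x≤s)


-- Truncated lists and sums

-- A window inside the revealed prefix does not notice that the prefix was cut before `tail` was
-- appended.
take-take-++ : ∀ {a} {A : Set a} {m n} → m ℕ.≤ n → (xs ys : List A) →
  take m (take n xs ++ ys) ≡ take m (xs ++ ys)
take-take-++ z≤n       xs       ys = refl
take-take-++ (s≤s m≤n) []       ys = refl
take-take-++ (s≤s m≤n) (x ∷ xs) ys = cong (x ∷_) (take-take-++ m≤n xs ys)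

tabulate-zipWith : ∀ {n} (f g : Fin n → ℕ) →
  tabulate (λ k → f k ℕ.+ g k) ≡ Vec.zipWith ℕ._+_ (tabulate f) (tabulate g)
tabulate-zipWith {zero}  f g = refl
tabulate-zipWith {suc n} f g =
  cong (f zero ℕ.+ g zero ∷_) (tabulate-zipWith (f ∘ suc) (g ∘ suc))

sum-upTo-suc : ∀ f n →
  sum (List.map f (List.upTo (suc n))) ≡ sum (List.map f (List.upTo n)) ℕ.+ f n
sum-upTo-suc f n = begin
  sum (List.map f (List.upTo (suc n)))           ≡⟨ cong (sum ∘ List.map f) (sym (upTo-∷ʳ n)) ⟩
  sum (List.map f (List.upTo n List.∷ʳ n))       ≡⟨ cong sum (map-++ f (List.upTo n) (n ∷ [])) ⟩
  sum (List.map f (List.upTo n) ++ f n ∷ [])     ≡⟨ sum-++ (List.map f (List.upTo n)) (f n ∷ []) ⟩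
  sum (List.map f (List.upTo n)) ℕ.+ (f n ℕ.+ 0) ≡⟨ cong (sum (List.map f (List.upTo n)) ℕ.+_)
                                                      (ℕₚ.+-identityʳ (f n)) ⟩
  sum (List.map f (List.upTo n)) ℕ.+ f n         ∎
  where open ≡-Reasoning

sum-upTo-extend : ∀ f m {n} → m ℕ.≤ n → (∀ i → m ℕ.≤ i → f i ≡ 0) →
  sum (List.map f (List.upTo n)) ≡ sum (List.map f (List.upTo m))
sum-upTo-extend f m m≤n f≡0 = go (ℕₚ.≤⇒≤′ m≤n)
  where
  go : ∀ {n} → m ℕ.≤′ n → sum (List.map f (List.upTo n)) ≡ sum (List.map f (List.upTo m))
  go ℕ.≤′-refl            = refl
  go (ℕ.≤′-step {n} m≤′n) = trans (sum-upTo-suc f n)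
    (trans (cong₂ ℕ._+_ (go m≤′n) (f≡0 n (ℕₚ.≤′⇒≤ m≤′n))) (ℕₚ.+-identityʳ _))


-- The algorithm for one server: windows, steps and runs

module Server {c ℓ} (F : ArchimedeanOrderedField c ℓ)
  {w : ℕ} (tail : Vec (Provisioning.Slot F) w)
  (β : ArchimedeanOrderedField.Carrier F) (j : ℕ) where

  open OrderedField F
  open Provisioning F
  open GCSR tail β using (State; ⟨_,_⟩; upToτ′; busy; step; steps; server)
  open SlotProperties F

  private
    i = suc j

  r : Slot → Carrier
  r s = p s * dᵢ s i

  Busy : Slot → Set _
  Busy s = 0# < aᵢ s i

  Busy? : ∀ s → Dec (Busy s)
  Busy? s = 0# <? aᵢ s i

  ¬Busy⇒aᵢ≤0 : ∀ {s} → ¬ Busy s → aᵢ s i ≤ 0#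
  ¬Busy⇒aᵢ≤0 {s} idle with aᵢ s i ≤? 0#
  ... | yes aᵢ≤0 = aᵢ≤0
  ... | no  aᵢ≰0 = contradiction (≰⇒> aᵢ≰0) idle

  -- A busy slot comes before the idling cost, starting from C, has reached β.
  data Short (C : Carrier) : List Slot → Set (c Level.⊔ ℓ) where
    here  : ∀ {s L} → Busy s → Short C (s ∷ L)
    there : ∀ {s L} → ¬ β ≤ C + r s → Short (C + r s) L → Short C (s ∷ L)

  idle⇒¬Short : ∀ {C L} → ListAll.All (λ s → ¬ Busy s) L → ¬ Short C L
  idle⇒¬Short (idle ListAll.∷ _)  (here b)    = idle b
  idle⇒¬Short (_ ListAll.∷ idles) (there _ q) = idle⇒¬Short idles q

  Short-take : ∀ {C} n L → Short C (take n L) → Short C L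
  Short-take (suc n) (s ∷ L) (here b)    = here b
  Short-take (suc n) (s ∷ L) (there u q) = there u (Short-take n L q)

  ¬Short-tail : ∀ {C s L} → ¬ Short C (s ∷ L) → β ≤ C + r s ⊎ ¬ Short (C + r s) L
  ¬Short-tail {C} {s} ¬short with β ≤? C + r s
  ... | yes β≤ = inj₁ β≤
  ... | no  β≰ = inj₂ (¬short ∘ there β≰)

  upToτ′-∷-nothing : ∀ C s L → upToτ′ i C (s ∷ L) ≡ nothing →
    ¬ β ≤ C + r s × upToτ′ i (C + r s) L ≡ nothing
  upToτ′-∷-nothing C s L eq with β ≤? C + r s
  ... | no β≰ with upToτ′ i (C + r s) L
  ...   | nothing = β≰ , refl

  -- Each slot of a window without τ′ uses up at least `m` of the room below β; a full window
  -- therefore leaves C far from β.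
  upToτ′-nothing : ∀ {m} C L → C ≤ β → ListAll.All (λ s → m ≤ r s) L →
    upToτ′ i C L ≡ nothing → C + ι (length L) * m ≤ β
  upToτ′-nothing {m} C [] C≤β _ _ = ≤-by ⟪ C≤β ⟫
    (solve 3 (λ b C m → b := C :+ :0 :* m :+ (b :- C)) refl β C m)
  upToτ′-nothing {m} C (s ∷ L) C≤β (m≤r ListAll.∷ m≤rs) eq
    with β≰ , eq′ ← upToτ′-∷-nothing C s L eq =
    ≤-by (⟪ upToτ′-nothing (C + r s) L (≰⇒≥ β≰) m≤rs eq′ ⟫ ⊕ ⟪ m≤r ⟫)
      (solve 5 (λ b C m r l →
          b := C :+ (:1 :+ l) :* m :+ ((b :- (C :+ r :+ l :* m)) :+ (r :- m)))
        refl β C m (r s) (ι (length L)))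

  -- The slot τ′ itself counts: the idling cost before it is still below β, so workload in τ′ makes
  -- the gap short.
  upToτ′-busy : ∀ C L {l} → upToτ′ i C L ≡ just l → Any Busy l → Short C L
  upToτ′-busy C (s ∷ L) eq b with β ≤? C + r s
  upToτ′-busy C (s ∷ L) refl (here b) | yes _ = here b
  ... | no β≰ with upToτ′ i (C + r s) L in eq′
  upToτ′-busy C (s ∷ L) refl (here b)  | no β≰ | just _ = here b
  upToτ′-busy C (s ∷ L) refl (there b) | no β≰ | just _ = there β≰ (upToτ′-busy _ L eq′ b)

  -- A window that contains τ′ decides about the whole future, as the idling cost has reached β at
  -- τ′ and no later slot can make the gap short.
  upToτ′-idle : ∀ n C L {l} → upToτ′ i C (take n L) ≡ just l → ¬ Any Busy l → ¬ Short C L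
  upToτ′-idle (suc n) C (s ∷ L) eq idle short with β ≤? C + r s
  upToτ′-idle (suc n) C (s ∷ L) refl idle (here b)     | yes _  = idle (here b)
  upToτ′-idle (suc n) C (s ∷ L) refl idle (there β≰ _) | yes β≤ = β≰ β≤
  ... | no _ with upToτ′ i (C + r s) (take n L) in eq′
  upToτ′-idle (suc n) C (s ∷ L) refl idle (here b)    | no _ | just _ = idle (here b)
  upToτ′-idle (suc n) C (s ∷ L) refl idle (there _ q) | no _ | just _ =
    upToτ′-idle n _ L eq′ (idle ∘ there) q

  busy-true : ∀ {L} → Any Busy L → busy i L ≡ true
  busy-true {L} = dec-true (any? Busy? L)

  busy-false : ∀ {L} → ¬ Any Busy L → busy i L ≡ false
  busy-false {L} = dec-false (any? Busy? L)

  ¬Any-[] : ∀ {s} → ¬ Busy s → ¬ Any Busy (s ∷ [])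
  ¬Any-[] idle (here b) = idle b

  step-busy : ∀ st s ws → Busy s → step i st (s ∷ ws) ≡ ⟨ 0# , 1 ⟩
  step-busy ⟨ C , x ⟩ s ws b rewrite busy-true (here {x = s} {xs = []} b) = refl

  -- The two ways of keeping the state are separated because they establish different alternatives
  -- of the invariant: `keep-null` a bound on C, `keep-busy` a short gap.
  data IdleStep (C : Carrier) (x : ℕ) (s : Slot) (ws : List Slot) : Set (c Level.⊔ ℓ) where
    keep-null : step i ⟨ C , x ⟩ (s ∷ ws) ≡ ⟨ C + r s * ι x , x ⟩ →
      upToτ′ i C (s ∷ ws) ≡ nothing → IdleStep C x s ws
    keep-busy : ∀ {l} → step i ⟨ C , x ⟩ (s ∷ ws) ≡ ⟨ C + r s * ι x , x ⟩ →
      upToτ′ i C (s ∷ ws) ≡ just l → Any Busy l → IdleStep C x s ws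
    off       : ∀ {l} → step i ⟨ C , x ⟩ (s ∷ ws) ≡ ⟨ 0# , 0 ⟩ →
      upToτ′ i C (s ∷ ws) ≡ just l → ¬ Any Busy l → IdleStep C x s ws

  step-idle : ∀ C x s ws → ¬ Busy s → IdleStep C x s ws
  step-idle C x s ws idle = go (upToτ′ i C (s ∷ ws)) refl
    where
    go : ∀ τ → upToτ′ i C (s ∷ ws) ≡ τ → IdleStep C x s ws
    go nothing eq = keep-null step≡ eq
      where
      step≡ : step i ⟨ C , x ⟩ (s ∷ ws) ≡ ⟨ C + r s * ι x , x ⟩
      step≡ rewrite busy-false (¬Any-[] {s} idle) | eq = refl
    go (just l) eq with any? Busy? l
    ... | yes b = keep-busy step≡ eq b
      where
      step≡ : step i ⟨ C , x ⟩ (s ∷ ws) ≡ ⟨ C + r s * ι x , x ⟩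
      step≡ rewrite busy-false (¬Any-[] {s} idle) | eq | busy-true b = refl
    ... | no ¬b = off step≡ eq ¬b
      where
      step≡ : step i ⟨ C , x ⟩ (s ∷ ws) ≡ ⟨ 0# , 0 ⟩
      step≡ rewrite busy-false (¬Any-[] {s} idle) | eq | busy-false ¬b = refl

  step-idle-x : ∀ C x s ws → ¬ Busy s →
    State.x (step i ⟨ C , x ⟩ (s ∷ ws)) ≡ x ⊎ State.x (step i ⟨ C , x ⟩ (s ∷ ws)) ≡ 0
  step-idle-x C x s ws idle with step-idle C x s ws idle
  ... | keep-null eq _   = inj₁ (cong State.x eq)
  ... | keep-busy eq _ _ = inj₁ (cong State.x eq)
  ... | off eq _ _       = inj₂ (cong State.x eq)

  -- Without workload an idle step keeps x or sets it to 0, so a server that is off stays off. This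
  -- justifies cutting the sum in `total` at the maximal load revealed so far.
  steps-idle : ∀ t C L → ListAll.All (λ s → ¬ Busy s) (L ++ toList tail) →
    State.x (steps i t ⟨ C , 0 ⟩ L) ≡ 0
  steps-idle zero    C L _     = refl
  steps-idle (suc t) C L idles with L ++ toList tail in eq
  steps-idle (suc t) C []      _ | []    = steps-idle t C [] (subst (ListAll.All _) (sym eq) ListAll.[])
  steps-idle (suc t) C L (idle ListAll.∷ idles) | s ∷ L′
    with step i ⟨ C , 0 ⟩ (s ∷ take w L′) | reduce (step-idle-x C 0 s (take w L′) idle)
  ... | ⟨ C′ , .0 ⟩ | refl = steps-idle t C′ (drop 1 L) (rest L eq)
    where
    rest : ∀ L → L ++ toList tail ≡ s ∷ L′ → ListAll.All (λ s → ¬ Busy s) (drop 1 L ++ toList tail)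
    -- Once the revealed slots are used up, `drop` has nothing to remove and the window keeps
    -- showing the unchanged `tail`.
    rest []      eq   = subst (ListAll.All _) (sym eq) (idle ListAll.∷ idles)
    rest (_ ∷ _) refl = idles

  next : State i → ∀ {n} → Slot → Vec Slot n → State i
  next st s ss = step i st (s ∷ take w (toList ss ++ toList tail))

  simulate : State i → ∀ {n} → Vec Slot n → Vec ℕ n
  simulate st []       = []
  simulate st (s ∷ ss) = State.x (next st s ss) ∷ simulate (next st s ss) ss

  -- `server` replays the revealed prefix from the start at every time. The replays fit together
  -- into one pass, because the window of each replayed step lies within the prefix revealed by
  -- then.
  run≡simulate : ∀ {n} (ss : Vec Slot n) → run w (server i) ss ≡ simulate ⟨ 0# , 0 ⟩ ss
  run≡simulate = go ⟨ 0# , 0 ⟩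
    where
    go : ∀ st {n} (ss : Vec Slot n) →
      tabulate (λ k → State.x (steps i (suc (toℕ k)) st (take (suc (toℕ k) ℕ.+ w) (toList ss))))
        ≡ simulate st ss
    go st []       = refl
    go st (s ∷ ss) = cong₂ _∷_
      (cong (λ ws → State.x (step i st (s ∷ ws))) (take-take-++ ℕₚ.≤-refl (toList ss) (toList tail)))
      (trans (tabulate-cong λ k → cong (λ ws → State.x (steps i (suc (toℕ k)) (step i st (s ∷ ws))
                 (take (suc (toℕ k) ℕ.+ w) (toList ss))))
               (take-take-++ (ℕₚ.m≤n+m w (suc (toℕ k))) (toList ss) (toList tail)))
             (go (next st s ss) ss))

  simulate-feasible : ∀ C x {n} (ss : Vec Slot n) → x ℕ.≤ 1 →
    Feasible (CPᵢ i) ss (simulate ⟨ C , x ⟩ ss)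
  simulate-feasible C x []       x≤1 = []
  simulate-feasible C x (s ∷ ss) x≤1 =
    (x′≤1 , aᵢ≤x′) ∷ simulate-feasible (State.C st′) (State.x st′) ss x′≤1
    where
    st′ = next ⟨ C , x ⟩ s ss
    x′≤1 : State.x st′ ℕ.≤ 1
    x′≤1 with Busy? s
    ... | yes b = ℕₚ.≤-reflexive (cong State.x (step-busy _ s _ b))
    ... | no ¬b with step-idle-x C x s (take w (toList ss ++ toList tail)) ¬b
    ...   | inj₁ eq = ℕₚ.≤-trans (ℕₚ.≤-reflexive eq) x≤1
    ...   | inj₂ eq = ℕₚ.≤-trans (ℕₚ.≤-reflexive eq) z≤n
    aᵢ≤x′ : aᵢ s i ≤ ι (State.x st′)
    aᵢ≤x′ with Busy? s
    ... | yes b = ≤-trans (aᵢ≤1 s i) (≤-reflexive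
      (trans (sym ι1) (cong (ι ∘ State.x) (sym (step-busy _ s _ b)))))
    ... | no ¬b = ≤-trans (¬Busy⇒aᵢ≤0 {s} ¬b) (ι-nonNeg (State.x st′))

-- The potential argument for one server

module _ {c ℓ} (F : ArchimedeanOrderedField c ℓ) where

  open OrderedField F

  -- The normalised window size enters only through β ≤ κβ + wm, where `m` is a lower bound on the
  -- idling cost of a slot; later κ = 1 - α and m = δ Pmin.
  module ServerBound {w : ℕ} (tail : Vec (Provisioning.Slot F) w)
    {β : Carrier} (0<β : 0# < β) (j : ℕ)
    {κ m : Carrier} (0≤κ : 0# ≤ κ) (0≤m : 0# ≤ m) (β≤κβ+wm : β ≤ κ * β + ι w * m) where

    open Provisioning F
    open GCSR tail β using (State; ⟨_,_⟩)
    open SlotProperties F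
    open Server F tail β j

    private
      i = suc j

    γ : Carrier
    γ = 1# + κ

    0≤γ : 0# ≤ γ
    0≤γ = 0≤1 ⊕ 0≤κ

    0≤β : 0# ≤ β
    0≤β = proj₁ 0<β

    private
      ⟦_⟧ : ∀ {n} → Vec Slot n → List Slot
      ⟦ ss ⟧ = toList ss ++ toList tail

      -- Thanks to `tail`, windows are full up to the end of the horizon, so that τ′ = NULL always
      -- accounts for w slots after the current one.
      ∣_∣≥w : ∀ {n} (ss : Vec Slot n) → length (take w ⟦ ss ⟧) ≡ w
      ∣ ss ∣≥w = trans (length-take w ⟦ ss ⟧) (ℕₚ.m≤n⇒m⊓n≡m (ℕₚ.≤-trans
        (ℕₚ.m≤n+m w (length (toList ss)))
        (ℕₚ.≤-reflexive (trans (cong (length (toList ss) ℕ.+_) (sym (length-toList tail)))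
          (sym (length-++ (toList ss)))))))

    -- κβ bounds the idling cost paid before a switch-off, provided that the gap
    -- without workload is not a short one.
    Invariant : Carrier → List Slot → Set _
    Invariant C L = 0# ≤ C × C ≤ β × (C ≤ κ * β ⊎ Short C L)

    W : ℕ → ∀ {n} → Vec Slot n → Vec ℕ n → Carrier
    W x ss ys = costFrom x β (CPᵢ i) ss ys

    V : Carrier → ℕ → ∀ {n} → Vec Slot n → Carrier
    V C x ss = W x ss (simulate ⟨ C , x ⟩ ss)

    -- The potentials 0, γC, κβ - C and κβ + κC, indexed by the states of the
    -- algorithm and of its competitor, in this order.
    record Bounds {n} (ss : Vec Slot n) (ys : Vec ℕ n) : Set (c Level.⊔ ℓ) where
      field
        b₀₀ : V 0# 0 ss ≤ γ * W 0 ss ys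
        b₀₁ : ∀ C → 0# ≤ C → β ≤ C ⊎ ¬ Short C ⟦ ss ⟧ → V 0# 0 ss ≤ γ * W 1 ss ys + γ * C
        b₁₀ : ∀ C → Invariant C ⟦ ss ⟧ → V C 1 ss + C ≤ γ * W 0 ss ys + κ * β
        b₁₁ : ∀ C → Invariant C ⟦ ss ⟧ → V C 1 ss ≤ γ * W 1 ss ys + (κ * β + κ * C)

    private
      via : ∀ {x x′ y y′} → x ≡ x′ → y ≡ y′ → x′ ≤ y′ → x ≤ y
      via refl refl x≤y = x≤y

    module _ {n} (s : Slot) (ss : Vec Slot n) (xs : Vec ℕ n) where

      W₀₀ : W 0 (s ∷ ss) (0 ∷ xs) ≡ W 0 ss xs
      W₀₀ rewrite ι-decrease (z≤n {0}) =
        solve 3 (λ r b V → r :* :0 :+ b :* :0 :+ V := V) refl (r s) β (W 0 ss xs)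

      W₁₀ : W 1 (s ∷ ss) (0 ∷ xs) ≡ W 0 ss xs
      W₁₀ rewrite ι-decrease (z≤n {1}) =
        solve 3 (λ r b V → r :* :0 :+ b :* :0 :+ V := V) refl (r s) β (W 0 ss xs)

      W₀₁ : W 0 (s ∷ ss) (1 ∷ xs) ≡ r s + β + W 1 ss xs
      W₀₁ rewrite ι-increase (z≤n {1}) =
        solve 3 (λ r b V → r :* (:1 :+ :0) :+ b :* (:1 :+ :0 :- :0) :+ V := r :+ b :+ V)
          refl (r s) β (W 1 ss xs)

      W₁₁ : W 1 (s ∷ ss) (1 ∷ xs) ≡ r s + W 1 ss xs
      W₁₁ rewrite ι-decrease (s≤s (z≤n {0})) =
        solve 3 (λ r b V → r :* (:1 :+ :0) :+ b :* :0 :+ V := r :+ V) refl (r s) β (W 1 ss xs)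

      W₀₁≡W₁₁+β : W 0 (s ∷ ss) (1 ∷ xs) ≡ W 1 (s ∷ ss) (1 ∷ xs) + β
      W₀₁≡W₁₁+β = trans W₀₁ (trans
        (solve 3 (λ r b V → r :+ b :+ V := r :+ V :+ b) refl (r s) β (W 1 ss xs))
        (cong (_+ β) (sym W₁₁)))

    simulate-∷ : ∀ {C x C′ x′ n} s (ss : Vec Slot n) → next ⟨ C , x ⟩ s ss ≡ ⟨ C′ , x′ ⟩ →
      simulate ⟨ C , x ⟩ (s ∷ ss) ≡ x′ ∷ simulate ⟨ C′ , x′ ⟩ ss
    simulate-∷ s ss eq = cong (λ st → State.x st ∷ simulate st ss) eq

    -- The counter grows by `r s * ι x`, which vanishes for a server that is off, so every branch of
    -- the step leads back to ⟨ 0# , 0 ⟩.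
    V-off-idle : ∀ {n} s (ss : Vec Slot n) → ¬ Busy s → V 0# 0 (s ∷ ss) ≡ V 0# 0 ss
    V-off-idle s ss idle = trans (cong (W 0 (s ∷ ss)) (simulate-∷ s ss next≡)) (W₀₀ s ss _)
      where
      0+r*0≡0 : ⟨_,_⟩ {i = i} (0# + r s * ι 0) 0 ≡ ⟨ 0# , 0 ⟩
      0+r*0≡0 = cong (λ C → ⟨ C , 0 ⟩) (solve 1 (λ r → :0 :+ r :* :0 := :0) refl (r s))
      next≡ : next ⟨ 0# , 0 ⟩ s ss ≡ ⟨ 0# , 0 ⟩
      next≡ with step-idle 0# 0 s (take w ⟦ ss ⟧) idle
      ... | keep-null eq _   = trans eq 0+r*0≡0
      ... | keep-busy eq _ _ = trans eq 0+r*0≡0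
      ... | off eq _ _       = eq

    V-off-busy : ∀ {n} s (ss : Vec Slot n) → Busy s → V 0# 0 (s ∷ ss) ≡ r s + β + V 0# 1 ss
    V-off-busy s ss b =
      trans (cong (W 0 (s ∷ ss)) (simulate-∷ s ss (step-busy _ s _ b))) (W₀₁ s ss _)

    V-on-busy : ∀ {C n} s (ss : Vec Slot n) → Busy s → V C 1 (s ∷ ss) ≡ r s + V 0# 1 ss
    V-on-busy s ss b =
      trans (cong (W 1 (s ∷ ss)) (simulate-∷ s ss (step-busy _ s _ b))) (W₁₁ s ss _)

    -- In `switched` the bound κβ concerns C without the current slot, for which the algorithm does
    -- not pay, whereas the gap is measured with this slot included, since a competitor that is on
    -- pays for it.
    data OnIdle (C : Carrier) {n} (s : Slot) (ss : Vec Slot n) : Set (c Level.⊔ ℓ) where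
      kept     : V C 1 (s ∷ ss) ≡ r s + V (C + r s) 1 ss → Invariant (C + r s) ⟦ ss ⟧ → OnIdle C s ss
      switched : V C 1 (s ∷ ss) ≡ V 0# 0 ss → C ≤ κ * β →
        β ≤ C + r s ⊎ ¬ Short (C + r s) ⟦ ss ⟧ → OnIdle C s ss

    V-on-idle : ∀ C {n} s (ss : Vec Slot n) → ¬ Busy s → ListAll.All (λ s → m ≤ r s) (s ∷ ⟦ ss ⟧) →
      Invariant C (s ∷ ⟦ ss ⟧) → OnIdle C s ss
    V-on-idle C s ss idle (m≤r ListAll.∷ m≤rs) (0≤C , C≤β , C≤κβ⊎short) =
      go (step-idle C 1 s (take w ⟦ ss ⟧) idle)
      where
      0≤C+r : 0# ≤ C + r s
      0≤C+r = 0≤C ⊕ ≤-trans 0≤m m≤r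

      V≡ : next ⟨ C , 1 ⟩ s ss ≡ ⟨ C + r s * ι 1 , 1 ⟩ → V C 1 (s ∷ ss) ≡ r s + V (C + r s) 1 ss
      V≡ eq = trans (cong (W 1 (s ∷ ss)) (simulate-∷ s ss (trans eq
          (cong (λ C → ⟨ C , 1 ⟩) (solve 2 (λ C r → C :+ r :* (:1 :+ :0) := C :+ r) refl C (r s))))))
        (W₁₁ s ss _)

      go : IdleStep C 1 s (take w ⟦ ss ⟧) → OnIdle C s ss
      go (keep-null eq null) with β≰ , null′ ← upToτ′-∷-nothing C s (take w ⟦ ss ⟧) null =
        -- No τ′ in a full window means C + r + wm ≤ β, and β ≤ κβ + wm turns this into C + r ≤ κβ.
        kept (V≡ eq) (0≤C+r , ≰⇒≥ β≰ , inj₁ (≤-by (⟪ C+r+wm≤β ⟫ ⊕ ⟪ β≤κβ+wm ⟫)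
          (solve 5 (λ k b C r v → k :* b := C :+ r :+ ((b :- (C :+ r :+ v)) :+ (k :* b :+ v :- b)))
            refl κ β C (r s) (ι w * m))))
        where
        C+r+wm≤β : C + r s + ι w * m ≤ β
        C+r+wm≤β = subst (λ l → C + r s + ι l * m ≤ β) ∣ ss ∣≥w
          (upToτ′-nothing (C + r s) (take w ⟦ ss ⟧) (≰⇒≥ β≰) (take⁺ w m≤rs) null′)
      go (keep-busy eq window b) with Short-take (suc w) (s ∷ ⟦ ss ⟧) (upToτ′-busy C _ window b)
      ... | here b′        = contradiction b′ idle
      ... | there β≰ short = kept (V≡ eq) (0≤C+r , ≰⇒≥ β≰ , inj₂ short)
      go (off eq window ¬b) = switched
        (trans (cong (W 1 (s ∷ ss)) (simulate-∷ s ss eq)) (W₁₀ s ss _))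
        (C≤κβ C≤κβ⊎short) (¬Short-tail ¬short)
        where
        ¬short : ¬ Short C (s ∷ ⟦ ss ⟧)
        ¬short = upToτ′-idle (suc w) C (s ∷ ⟦ ss ⟧) window ¬b
        C≤κβ : C ≤ κ * β ⊎ Short C (s ∷ ⟦ ss ⟧) → C ≤ κ * β
        C≤κβ (inj₁ C≤) = C≤
        C≤κβ (inj₂ short) = contradiction short ¬short

    0≤κβ : 0# ≤ κ * β
    0≤κβ = 0≤κ ⊛ 0≤β

    module _ {n} {s : Slot} {ss : Vec Slot n} {ys : Vec ℕ n}
      (m≤r : ListAll.All (λ s → m ≤ r s) (s ∷ ⟦ ss ⟧)) (ih : Bounds ss ys) where

      open Bounds ih

      private
        0≤r : 0# ≤ r s
        0≤r = ≤-trans 0≤m (ListAll.head m≤r)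

        initial : ∀ {L} → Invariant 0# L
        initial = ≤-refl , 0≤β , inj₁ 0≤κβ

      -- Switching off is free, so the previous state of the competitor does not affect its cost.
      -- The potentials for a competitor that was on only have to dominate the other two: γC ≥ 0 and
      -- κβ + κC ≥ κβ - C.
      bounds-0 : ¬ Busy s → Bounds (s ∷ ss) (0 ∷ ys)
      bounds-0 idle = record
        { b₀₀ = c₀₀
        ; b₀₁ = λ C 0≤C _ → ≤-trans (via refl (cong (γ *_) W₁₀≡W₀₀) c₀₀)
            (≤-by (0≤γ ⊛ 0≤C) refl)
        ; b₁₀ = c₁₀
        ; b₁₁ = λ C inv → ≤-by (⟪ c₁₀ C inv ⟫ ⊕ (0≤κ ⊛ proj₁ inv) ⊕ proj₁ inv)
            (trans (cong (λ W → γ * W + (κ * β + κ * C)) W₁₀≡W₀₀)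
              (solve 5 (λ k b C V R → R :+ (k :* b :+ k :* C)
                  := V :+ (R :+ k :* b :- (V :+ C) :+ k :* C :+ C))
                refl κ β C (V C 1 (s ∷ ss)) (γ * W 0 (s ∷ ss) (0 ∷ ys))))
        }
        where
        W₁₀≡W₀₀ : W 1 (s ∷ ss) (0 ∷ ys) ≡ W 0 (s ∷ ss) (0 ∷ ys)
        W₁₀≡W₀₀ = trans (W₁₀ s ss ys) (sym (W₀₀ s ss ys))
        c₀₀ : V 0# 0 (s ∷ ss) ≤ γ * W 0 (s ∷ ss) (0 ∷ ys)
        c₀₀ = via (V-off-idle s ss idle) (cong (γ *_) (W₀₀ s ss ys)) b₀₀
        c₁₀ : ∀ C → Invariant C ⟦ s ∷ ss ⟧ → V C 1 (s ∷ ss) + C ≤ γ * W 0 (s ∷ ss) (0 ∷ ys) + κ * β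
        c₁₀ C inv = go (V-on-idle C s ss idle m≤r inv)
          where
          W≡ = cong (λ W → γ * W + κ * β) (W₀₀ s ss ys)
          go : OnIdle C s ss → V C 1 (s ∷ ss) + C ≤ γ * W 0 (s ∷ ss) (0 ∷ ys) + κ * β
          go (kept V≡ inv′) = via (cong (_+ C) V≡) W≡ (≤-by ⟪ b₁₀ (C + r s) inv′ ⟫
            (solve 4 (λ r V C R → R := r :+ V :+ C :+ (R :- (V :+ (C :+ r)))) refl
              (r s) (V (C + r s) 1 ss) C (γ * W 0 ss ys + κ * β)))
          go (switched V≡ C≤κβ _) = via (cong (_+ C) V≡) W≡ (+-mono-≤ b₀₀ C≤κβ)

      -- A competitor that was off pays β more than one that was on, and γβ makes up for the
      -- difference of the potentials: from 0 to γC taken at C = β, and from κβ - C to κβ + κC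
      -- because γC ≤ γβ.
      bounds-1 : Bounds (s ∷ ss) (1 ∷ ys)
      bounds-1 = record
        { b₀₀ = via refl (cong (γ *_) (W₀₁≡W₁₁+β s ss ys))
            (≤-trans (c₀₁ β 0≤β (inj₁ ≤-refl)) (≤-reflexive
              (solve 3 (λ g W b → g :* W :+ g :* b := g :* (W :+ b)) refl γ (W 1 (s ∷ ss) (1 ∷ ys)) β)))
        ; b₀₁ = c₀₁
        ; b₁₀ = λ C inv@(_ , C≤β , _) →
            via refl (cong (λ W → γ * W + κ * β) (W₀₁≡W₁₁+β s ss ys))
              (≤-by (⟪ c₁₁ C inv ⟫ ⊕ (0≤γ ⊛ ⟪ C≤β ⟫))
                (solve 5 (λ k b C V W → (:1 :+ k) :* (W :+ b) :+ k :* b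
                    := V :+ C :+ (((:1 :+ k) :* W :+ (k :* b :+ k :* C) :- V) :+ (:1 :+ k) :* (b :- C)))
                  refl κ β C (V C 1 (s ∷ ss)) (W 1 (s ∷ ss) (1 ∷ ys))))
        ; b₁₁ = c₁₁
        }
        where
        c₀₁ : ∀ C → 0# ≤ C → β ≤ C ⊎ ¬ Short C ⟦ s ∷ ss ⟧ →
          V 0# 0 (s ∷ ss) ≤ γ * W 1 (s ∷ ss) (1 ∷ ys) + γ * C
        c₀₁ C 0≤C long with Busy? s
        -- Workload right now means that a gap which is not short has already cost β. Hence γC ≥ β +
        -- κβ, the switch-on and a full reserve.
        ... | yes b = via (V-off-busy s ss b) (cong (λ W → γ * W + γ * C) (W₁₁ s ss ys))
          (≤-by (⟪ b₁₁ 0# initial ⟫ ⊕ (0≤κ ⊛ 0≤r) ⊕ (0≤γ ⊛ ⟪ β≤C long ⟫))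
            (solve 6 (λ k b C r V W → (:1 :+ k) :* (r :+ W) :+ (:1 :+ k) :* C
                := r :+ b :+ V :+ (((:1 :+ k) :* W :+ (k :* b :+ k :* :0) :- V) :+ k :* r
                     :+ (:1 :+ k) :* (C :- b)))
              refl κ β C (r s) (V 0# 1 ss) (W 1 ss ys)))
          where
          β≤C : β ≤ C ⊎ ¬ Short C ⟦ s ∷ ss ⟧ → β ≤ C
          β≤C (inj₁ β≤C)    = β≤C
          β≤C (inj₂ ¬short) = contradiction (here b) ¬short
        ... | no idle = via (V-off-idle s ss idle) (cong (λ W → γ * W + γ * C) (W₁₁ s ss ys))
          (≤-trans (b₀₁ (C + r s) (0≤C ⊕ 0≤r) (long′ long)) (≤-reflexive
            (solve 4 (λ g W C r → g :* W :+ g :* (C :+ r) := g :* (r :+ W) :+ g :* C)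
              refl γ (W 1 ss ys) C (r s))))
          where
          long′ : β ≤ C ⊎ ¬ Short C ⟦ s ∷ ss ⟧ → β ≤ C + r s ⊎ ¬ Short (C + r s) ⟦ ss ⟧
          long′ (inj₁ β≤C)    = inj₁ (≤-trans β≤C (≤-by 0≤r refl))
          long′ (inj₂ ¬short) = ¬Short-tail ¬short

        c₁₁ : ∀ C → Invariant C ⟦ s ∷ ss ⟧ →
          V C 1 (s ∷ ss) ≤ γ * W 1 (s ∷ ss) (1 ∷ ys) + (κ * β + κ * C)
        c₁₁ C inv@(0≤C , _) with Busy? s
        ... | yes b = via (V-on-busy s ss b) (cong (λ W → γ * W + (κ * β + κ * C)) (W₁₁ s ss ys))
          (≤-by (⟪ b₁₁ 0# initial ⟫ ⊕ (0≤κ ⊛ 0≤r) ⊕ (0≤κ ⊛ 0≤C))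
            (solve 6 (λ k b C r V W → (:1 :+ k) :* (r :+ W) :+ (k :* b :+ k :* C)
                := r :+ V :+ (((:1 :+ k) :* W :+ (k :* b :+ k :* :0) :- V) :+ k :* r :+ k :* C))
              refl κ β C (r s) (V 0# 1 ss) (W 1 ss ys)))
        ... | no idle = go (V-on-idle C s ss idle m≤r inv)
          where
          W≡ = cong (λ W → γ * W + (κ * β + κ * C)) (W₁₁ s ss ys)
          go : OnIdle C s ss → V C 1 (s ∷ ss) ≤ γ * W 1 (s ∷ ss) (1 ∷ ys) + (κ * β + κ * C)
          go (kept V≡ inv′) = via V≡ W≡ (≤-by ⟪ b₁₁ (C + r s) inv′ ⟫
            (solve 6 (λ k b C r V W → (:1 :+ k) :* (r :+ W) :+ (k :* b :+ k :* C)
                := r :+ V :+ ((:1 :+ k) :* W :+ (k :* b :+ k :* (C :+ r)) :- V))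
              refl κ β C (r s) (V (C + r s) 1 ss) (W 1 ss ys)))
          -- The new potential is γ(C + r). The competitor's own payment covers γr, and γC ≤ κβ + κC
          -- is C ≤ κβ.
          go (switched V≡ C≤κβ long) = via V≡ W≡
            (≤-by (⟪ b₀₁ (C + r s) (0≤C ⊕ 0≤r) long ⟫ ⊕ ⟪ C≤κβ ⟫)
              (solve 6 (λ k b C r V W → (:1 :+ k) :* (r :+ W) :+ (k :* b :+ k :* C)
                  := V :+ ((:1 :+ k) :* W :+ (:1 :+ k) :* (C :+ r) :- V :+ (k :* b :- C)))
                refl κ β C (r s) (V 0# 0 ss) (W 1 ss ys)))

    bounds : ∀ {n} (ss : Vec Slot n) ys → ListAll.All (λ s → m ≤ r s) ⟦ ss ⟧ →
      ListAll.All (λ s → ¬ Busy s) (toList tail) → Feasible (CPᵢ i) ss ys → Bounds ss ys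
    bounds [] [] _ idle [] = record
      { b₀₀ = ≤-by ≤-refl (solve 1 (λ g → g :* :0 := :0 :+ :0) refl γ)
      ; b₀₁ = λ C 0≤C _ → ≤-by (0≤γ ⊛ 0≤C)
          (solve 2 (λ g C → g :* :0 :+ g :* C := :0 :+ g :* C) refl γ C)
      ; b₁₀ = λ { C (_ , _ , inj₁ C≤κβ) → ≤-by ⟪ C≤κβ ⟫
                    (solve 4 (λ g k b C → g :* :0 :+ k :* b := :0 :+ C :+ (k :* b :- C)) refl γ κ β C)
                -- Idling in expectation of workload beyond the horizon would never be compensated;
                -- the idle `tail` excludes it.
                ; C (_ , _ , inj₂ short) → contradiction short (idle⇒¬Short idle) }
      ; b₁₁ = λ C inv → ≤-by (0≤κβ ⊕ (0≤κ ⊛ proj₁ inv))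
          (solve 4 (λ g k b C → g :* :0 :+ (k :* b :+ k :* C) := :0 :+ (k :* b :+ k :* C)) refl γ κ β C)
      }
    bounds (s ∷ ss) (0 ∷ ys) m≤r@(_ ListAll.∷ m≤rs) idle ((_ , aᵢ≤0) ∷ feasible) =
      bounds-0 m≤r (bounds ss ys m≤rs idle feasible) (λ b → <⇒≱ b aᵢ≤0)
    bounds (s ∷ ss) (1 ∷ ys) m≤r@(_ ListAll.∷ m≤rs) idle (_ ∷ feasible) =
      bounds-1 m≤r (bounds ss ys m≤rs idle feasible)
    bounds (s ∷ ss) (suc (suc _) ∷ ys) _ _ ((s≤s () , _) ∷ _)

-- Decomposition of CP into the problems CPᵢ

module _ {c ℓ} (F : ArchimedeanOrderedField c ℓ) where

  open OrderedField F

  module CostDecomposition {β : Carrier} (0≤β : 0# ≤ β) where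

    open Provisioning F
    open SlotProperties F

    0≤β*[_]⁺ : ∀ z → 0# ≤ β * [ z ]⁺
    0≤β*[ z ]⁺ = 0≤β ⊛ 0≤[ z ]⁺

    cost-nonNeg : ∀ P {n} x₀ (ss : Vec Slot n) xs →
      VecAll.All (λ s → ∀ x → 0# ≤ running P s x) ss → 0# ≤ costFrom x₀ β P ss xs
    cost-nonNeg P x₀ []       []       VecAll.[]          = ≤-refl
    cost-nonNeg P x₀ (s ∷ ss) (x ∷ xs) (0≤r VecAll.∷ 0≤rs) =
      0≤r x ⊕ 0≤β*[ ι x - ι x₀ ]⁺ ⊕ cost-nonNeg P x ss xs 0≤rs

    module _ {f g : ℕ → ℕ}
      (f-mono : ∀ {x y} → x ℕ.≤ y → f x ℕ.≤ f y) (g-mono : ∀ {x y} → x ℕ.≤ y → g x ℕ.≤ g y) where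

      -- Two monotone functions of the same server count change in the same direction, and on
      -- numbers of equal sign the positive part is additive.
      switching-split : ∀ x₀ x → [ ι (f x) - ι (f x₀) ]⁺ + [ ι (g x) - ι (g x₀) ]⁺
        ≤ [ ι (f x ℕ.+ g x) - ι (f x₀ ℕ.+ g x₀) ]⁺
      switching-split x₀ x with ℕₚ.≤-total x₀ x
      ... | inj₁ x₀≤x rewrite ι-increase (f-mono x₀≤x) | ι-increase (g-mono x₀≤x) =
        ≤-trans (≤-reflexive (trans
          (solve 4 (λ a b u v → a :- b :+ (u :- v) := a :+ u :- (b :+ v)) refl
            (ι (f x)) (ι (f x₀)) (ι (g x)) (ι (g x₀)))
          (sym (cong₂ _-_ (ι-+ (f x) (g x)) (ι-+ (f x₀) (g x₀))))))
          ≤[ ι (f x ℕ.+ g x) - ι (f x₀ ℕ.+ g x₀) ]⁺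
      ... | inj₂ x≤x₀ rewrite ι-decrease (f-mono x≤x₀) | ι-decrease (g-mono x≤x₀) =
        ≤-trans (≤-reflexive (+-identityʳ 0#)) 0≤[ _ ]⁺

      switching-part : ∀ x₀ x → [ ι (f x) - ι (f x₀) ]⁺ ≤ [ ι (f x ℕ.+ g x) - ι (f x₀ ℕ.+ g x₀) ]⁺
      switching-part x₀ x = ≤-trans (≤-by 0≤[ _ ]⁺ refl) (switching-split x₀ x)

    -- The decision for server M + 1 in a solution with y servers.
    above : ℕ → ℕ → ℕ
    above M y = 1 ℕ.⊓ (y ℕ.∸ M)

    above-mono : ∀ M {x y} → x ℕ.≤ y → above M x ℕ.≤ above M y
    above-mono M x≤y = ℕₚ.⊓-monoʳ-≤ 1 (ℕₚ.∸-monoˡ-≤ M x≤y)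

    above≤1 : ∀ M y → above M y ℕ.≤ 1
    above≤1 M y = ℕₚ.m⊓n≤m 1 _

    ⊓+above : ∀ M y → M ℕ.⊓ y ℕ.+ above M y ≡ suc M ℕ.⊓ y
    ⊓+above zero    zero    = refl
    ⊓+above zero    (suc y) = refl
    ⊓+above (suc M) zero    = refl
    ⊓+above (suc M) (suc y) = cong suc (⊓+above M y)

    y≤M⇒above≡0 : ∀ {M y} → y ℕ.≤ M → above M y ≡ 0
    y≤M⇒above≡0 y≤M = cong (1 ℕ.⊓_) (ℕₚ.m≤n⇒m∸n≡0 y≤M)

    y>M⇒above≡1 : ∀ {M y} → M ℕ.< y → above M y ≡ 1
    y>M⇒above≡1 M<y = ℕₚ.m≤n⇒m⊓n≡m (ℕₚ.m<n⇒0<n∸m M<y)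

    -- The part cut off, y ∸ M, never moves against M ⊓ y, so truncation adds no switching. It
    -- removes servers above the maximal load, and with M = 1 it reduces an optimum to decisions in
    -- {0, 1}.
    cost-truncate : ∀ P M {n} x₀ (ss : Vec Slot n) xs →
      VecAll.All (λ s → ∀ x → running P s (M ℕ.⊓ x) ≤ running P s x) ss →
      costFrom (M ℕ.⊓ x₀) β P ss (Vec.map (M ℕ.⊓_) xs) ≤ costFrom x₀ β P ss xs
    cost-truncate P M x₀ []       []       VecAll.[]          = ≤-refl
    cost-truncate P M x₀ (s ∷ ss) (x ∷ xs) (r≤ VecAll.∷ rs≤) =
      +-mono-≤ (+-mono-≤ (r≤ x) (*-monoˡ-≤-nonNeg 0≤β switching)) (cost-truncate P M x ss xs rs≤)
      where
      switching : [ ι (M ℕ.⊓ x) - ι (M ℕ.⊓ x₀) ]⁺ ≤ [ ι x - ι x₀ ]⁺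
      switching = ≤-trans (switching-part (ℕₚ.⊓-monoʳ-≤ M) (ℕₚ.∸-monoˡ-≤ M) x₀ x)
        (≤-reflexive (cong₂ (λ x x₀ → [ ι x - ι x₀ ]⁺) (ℕₚ.m⊓n+n∸m≡n M x) (ℕₚ.m⊓n+n∸m≡n M x₀)))

    running-split : ∀ s M y →
      running CP s (M ℕ.⊓ y) + running (CPᵢ (suc M)) s (above M y) ≡ running CP s (suc M ℕ.⊓ y)
    running-split s M y with ℕₚ.≤-<-connex y M
    ... | inj₁ y≤M
      rewrite y≤M⇒above≡0 y≤M | ℕₚ.m≥n⇒m⊓n≡n y≤M | ℕₚ.m≥n⇒m⊓n≡n (ℕₚ.m≤n⇒m≤1+n y≤M) =
      solve 3 (λ p d e → p :* d :+ p :* e :* :0 := p :* d) refl (p s) (d s y) (dᵢ s (suc M))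
    ... | inj₂ M<y
      rewrite y>M⇒above≡1 M<y | ℕₚ.m≤n⇒m⊓n≡m (ℕₚ.<⇒≤ M<y) | ℕₚ.m≤n⇒m⊓n≡m M<y =
      solve 3 (λ p d d′ → p :* d :+ p :* (d′ :- d) :* (:1 :+ :0) := p :* d′) refl
        (p s) (d s M) (d s (suc M))

    cost-split : ∀ M {n} y₀ (ss : Vec Slot n) ys →
      costFrom (M ℕ.⊓ y₀) β CP ss (Vec.map (M ℕ.⊓_) ys)
        + costFrom (above M y₀) β (CPᵢ (suc M)) ss (Vec.map (above M) ys)
        ≤ costFrom (suc M ℕ.⊓ y₀) β CP ss (Vec.map (suc M ℕ.⊓_) ys)
    cost-split M y₀ []       []       = ≤-reflexive (+-identityʳ 0#)
    cost-split M y₀ (s ∷ ss) (y ∷ ys) =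
      ≤-trans (≤-reflexive (solve 7 (λ r r′ b u u′ V V′ →
            r :+ b :* u :+ V :+ (r′ :+ b :* u′ :+ V′) := r :+ r′ :+ b :* (u :+ u′) :+ (V :+ V′))
          refl (running CP s (M ℕ.⊓ y)) (running (CPᵢ (suc M)) s (above M y)) β
            [ ι (M ℕ.⊓ y) - ι (M ℕ.⊓ y₀) ]⁺ [ ι (above M y) - ι (above M y₀) ]⁺
            (costFrom (M ℕ.⊓ y) β CP ss (Vec.map (M ℕ.⊓_) ys))
            (costFrom (above M y) β (CPᵢ (suc M)) ss (Vec.map (above M) ys))))
        (+-mono-≤ (+-mono-≤ (≤-reflexive (running-split s M y)) (*-monoˡ-≤-nonNeg 0≤β switching))
          (cost-split M y ss ys))
      where
      switching : [ ι (M ℕ.⊓ y) - ι (M ℕ.⊓ y₀) ]⁺ + [ ι (above M y) - ι (above M y₀) ]⁺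
        ≤ [ ι (suc M ℕ.⊓ y) - ι (suc M ℕ.⊓ y₀) ]⁺
      switching = ≤-trans (switching-split (ℕₚ.⊓-monoʳ-≤ M) (above-mono M) y₀ y)
        (≤-reflexive (cong₂ (λ x x₀ → [ ι x - ι x₀ ]⁺) (⊓+above M y) (⊓+above M y₀)))

    module _ {Pmin Pmax : Carrier} (0≤Pmin : 0# ≤ Pmin) where

      0≤p : ∀ {s} → Valid Pmin Pmax s → 0# ≤ p s
      0≤p valid = ≤-trans 0≤Pmin (Valid.p-lower valid)

      running-add : ∀ {s M x z} → Valid Pmin Pmax s → x ℕ.≤ M → z ℕ.≤ 1 →
        running CP s (x ℕ.+ z) ≤ running CP s x + running (CPᵢ (suc M)) s z
      running-add {s} {M} {x} {zero} valid x≤M _ rewrite ℕₚ.+-identityʳ x = ≤-reflexive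
        (solve 3 (λ p d e → p :* d := p :* d :+ p :* e :* :0) refl (p s) (d s x) (dᵢ s (suc M)))
      running-add {s} {M} {x} {suc zero} valid x≤M _ rewrite ℕₚ.+-comm x 1 =
        ≤-by (0≤p valid ⊛ ⟪ dᵢ-mono valid x≤M ⟫)
          (solve 4 (λ p d d′ e → p :* d :+ p :* e :* (:1 :+ :0)
              := p :* d′ :+ p :* (e :- (d′ :- d)))
            refl (p s) (d s x) (d s (suc x)) (dᵢ s (suc M)))
      running-add {z = suc (suc _)} valid x≤M (s≤s ())

      -- Power is convex in the number of servers, so any x ≤ M servers cost at
      -- most the increments of the ones that are on, whichever these are.
      cost-add : ∀ {M n} x₀ z₀ (ss : Vec Slot n) xs zs → VecAll.All (Valid Pmin Pmax) ss →
        VecAll.All (ℕ._≤ M) xs → VecAll.All (ℕ._≤ 1) zs →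
        costFrom (x₀ ℕ.+ z₀) β CP ss (Vec.zipWith ℕ._+_ xs zs)
          ≤ costFrom x₀ β CP ss xs + costFrom z₀ β (CPᵢ (suc M)) ss zs
      cost-add x₀ z₀ [] [] [] _ _ _ = ≤-reflexive (sym (+-identityʳ 0#))
      cost-add {M} x₀ z₀ (s ∷ ss) (x ∷ xs) (z ∷ zs)
        (valid VecAll.∷ valids) (x≤M VecAll.∷ xs≤M) (z≤1 VecAll.∷ zs≤1) =
        ≤-trans (+-mono-≤ (+-mono-≤ (running-add valid x≤M z≤1) (*-monoˡ-≤-nonNeg 0≤β switching))
                  (cost-add x z ss xs zs valids xs≤M zs≤1))
          (≤-reflexive (solve 7 (λ r r′ b u u′ V V′ →
              r :+ r′ :+ b :* (u :+ u′) :+ (V :+ V′) := r :+ b :* u :+ V :+ (r′ :+ b :* u′ :+ V′))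
            refl (running CP s x) (running (CPᵢ (suc M)) s z) β
              [ ι x - ι x₀ ]⁺ [ ι z - ι z₀ ]⁺
              (costFrom x β CP ss xs) (costFrom z β (CPᵢ (suc M)) ss zs)))
        where
        switching : [ ι (x ℕ.+ z) - ι (x₀ ℕ.+ z₀) ]⁺ ≤ [ ι x - ι x₀ ]⁺ + [ ι z - ι z₀ ]⁺
        switching = ≤-trans
          (≤-reflexive (cong [_]⁺ (trans (cong₂ _-_ (ι-+ x z) (ι-+ x₀ z₀))
            (solve 4 (λ x z x₀ z₀ → x :+ z :- (x₀ :+ z₀) := x :- x₀ :+ (z :- z₀)) refl
              (ι x) (ι z) (ι x₀) (ι z₀)))))
          ([]⁺-subadditive (ι x - ι x₀) (ι z - ι z₀))

    above-feasible : ∀ M {n} {ss : Vec Slot n} {ys} →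
      Feasible CP ss ys → Feasible (CPᵢ (suc M)) ss (Vec.map (above M) ys)
    above-feasible M [] = []
    above-feasible M {ss = s ∷ _} {y ∷ _} (a≤y ∷ feasible) =
      (above≤1 M y , admissible) ∷ above-feasible M feasible
      where
      admissible : aᵢ s (suc M) ≤ ι (above M y)
      admissible with ℕₚ.≤-<-connex y M
      ... | inj₁ y≤M = ≤-trans (a≤i⇒aᵢ≤0 s M (≤-trans a≤y (ι-mono y≤M))) (ι-nonNeg (above M y))
      ... | inj₂ M<y = ≤-trans (aᵢ≤1 s (suc M))
        (≤-reflexive (trans (sym ι1) (cong ι (sym (y>M⇒above≡1 M<y)))))

-- The ratio 2 - α is achieved

module Achievability {c ℓ} (F : ArchimedeanOrderedField c ℓ) (w : ℕ)
  (π : Provisioning.Parameters F) where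

  open OrderedField F
  open Provisioning F
  open Parameters π
  open SlotProperties F
  open CostDecomposition F (proj₁ 0<β)

  private
    0≤m : ∀ {δ} → 0# ≤ δ → 0# ≤ δ * Pmin
    0≤m 0≤δ = 0≤δ ⊛ 0≤Pmin

  α-normalised : α-Normalised w π
  α-normalised δ 0≤δ =
    min-glb 0≤1 (ι-nonNeg w ⊛ 0≤δ ⊛ 0≤Pmin ⊛ ⁻¹-nonNeg 0<β) , min≤x 1# _

  dMin-nonNeg : ∀ {n} (ss : Vec Slot (suc n)) → VecAll.All (Valid Pmin Pmax) ss → 0# ≤ dMin ss
  dMin-nonNeg ss valids = dMin-glb ss (VecAll.map (λ v → ⟪ d-mono v (z≤n {1}) ⟫) valids)

  maxLoad-bound : ∀ L → ListAll.All (λ s → a s ≤ ι (maxLoad L)) L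
  maxLoad-bound []      = ListAll.[]
  maxLoad-bound (s ∷ L) =
    ≤-trans (x≤⌈x⌉ (a s)) (ι-mono (ℕₚ.m≤m⊔n ⌈ a s ⌉ (maxLoad L)))
      ListAll.∷ ListAll.map (λ a≤ → ≤-trans a≤ (ι-mono (ℕₚ.m≤n⊔m ⌈ a s ⌉ (maxLoad L))))
        (maxLoad-bound L)

  maxLoad-take : ∀ k L → maxLoad (take k L) ℕ.≤ maxLoad L
  maxLoad-take zero    L       = z≤n
  maxLoad-take (suc k) []      = z≤n
  maxLoad-take (suc k) (s ∷ L) = ℕₚ.⊔-monoʳ-≤ ⌈ a s ⌉ (maxLoad-take k L)

  module _ {δ} (0≤δ : 0# ≤ δ) (tail : Vec Slot w) (idle : VecAll.All (Idle Pmin Pmax δ) tail) where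

    open GCSR tail β using (server)

    κ = 1# - α w π δ

    0≤κ : 0# ≤ κ
    0≤κ = ⟪ proj₂ (α-normalised δ 0≤δ) ⟫

    γ = 1# + κ

    -- One bound of the minimum α each: α ≤ 1 gave κ ≥ 0, and α ≤ w δ Pmin / β gives this.
    β≤κβ+wm : β ≤ κ * β + ι w * (δ * Pmin)
    β≤κβ+wm = ≤-by ⟪ αβ≤wm ⟫
      (solve 5 (λ a b w d p → (:1 :- a) :* b :+ w :* (d :* p) := b :+ (w :* d :* p :- a :* b)) refl
        (α w π δ) β (ι w) δ Pmin)
      where
      αβ≤wm : α w π δ * β ≤ ι w * δ * Pmin
      αβ≤wm = subst (α w π δ * β ≤_) (x*y⁻¹*y≡x (ι w * δ * Pmin) 0<β)
        (*-monoʳ-≤-nonNeg (proj₁ 0<β) (min≤y 1# _))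

    power-bound : ∀ {s} j → Valid Pmin Pmax s → δ ≤ d s 1 - d s 0 → δ * Pmin ≤ p s * dᵢ s (suc j)
    power-bound {s} j valid δ≤d = ≤-by
      ((⟪ Valid.p-lower valid ⟫ ⊛ ≤-trans 0≤δ δ≤dᵢ) ⊕ (0≤Pmin ⊛ ⟪ δ≤dᵢ ⟫))
      (solve 4 (λ p P d e → p :* e := d :* P :+ ((p :- P) :* e :+ P :* (e :- d))) refl
        (p s) Pmin δ (dᵢ s (suc j)))
      where
      δ≤dᵢ : δ ≤ dᵢ s (suc j)
      δ≤dᵢ = ≤-trans δ≤d (d₁≤dᵢ valid j)

    tail-idle : ∀ i → VecAll.All (λ s → aᵢ s (suc i) ≤ 0#) tail
    tail-idle i = VecAll.map (λ {s} h → a≤i⇒aᵢ≤0 s i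
      (≤-trans (≤-reflexive (Idle.noWorkload h)) (ι-nonNeg i))) idle

    module _ {n} (ss : Vec Slot n) (valid : VecAll.All (Valid Pmin Pmax) ss)
      (δ≤ : VecAll.All (λ s → δ ≤ d s 1 - d s 0) ss) where

      server-feasible : ∀ j → Feasible (CPᵢ (suc j)) ss (run w (GCSRₛ tail β (suc j)) ss)
      server-feasible j = subst (Feasible (CPᵢ (suc j)) ss) (sym (run≡simulate ss))
        (simulate-feasible 0# 0 ss z≤n)
        where open Server F tail β j

      server-bound : ∀ j ys → Feasible (CPᵢ (suc j)) ss ys →
        cost β (CPᵢ (suc j)) ss (run w (GCSRₛ tail β (suc j)) ss) ≤ γ * cost β (CPᵢ (suc j)) ss ys
      server-bound j ys feasible = ≤-trans (≤-reflexive (cong (cost β (CPᵢ (suc j)) ss) (run≡simulate ss)))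
        (Bounds.b₀₀ (bounds ss ys (++⁺ (toList⁺ m≤r) (toList⁺ m≤r-tail))
          (toList⁺ (VecAll.map (λ a≤0 b → <⇒≱ b a≤0) (tail-idle j))) feasible))
        where
        open Server F tail β j
        open ServerBound F tail 0<β j 0≤κ (0≤m 0≤δ) β≤κβ+wm
        m≤r : VecAll.All (λ s → δ * Pmin ≤ r s) ss
        m≤r = VecAll.map (λ (v , δ≤d) → power-bound j v δ≤d) (VecAll.zip (valid , δ≤))
        m≤r-tail : VecAll.All (λ s → δ * Pmin ≤ r s) tail
        m≤r-tail = VecAll.map (λ h → power-bound j (Idle.valid h) (Idle.δ≤d h)) idle

      -- A number of servers independent of time allows induction on it.
      firstServers : ℕ → Online
      firstServers M t revealed = sum (List.map (λ i → server (suc i) t revealed) (List.upTo M))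

      X : ℕ → Vec ℕ n
      X M = run w (firstServers M) ss

      X-suc : ∀ M → X (suc M) ≡ Vec.zipWith ℕ._+_ (X M) (run w (GCSRₛ tail β (suc M)) ss)
      X-suc M = trans (tabulate-cong λ k → sum-upTo-suc _ M) (tabulate-zipWith _ _)

      -- If a(t) > M, then each of the servers 1, …, M has workload and is on.
      X-bounds : ∀ M → VecAll.All (ℕ._≤ M) (X M) × Pointwise (λ s x → M ℕ.≤ x ⊎ a s ≤ ι x) ss (X M)
      X-bounds zero    = VecAllₚ.tabulate⁺ (λ _ → z≤n) , zeros ss
        where
        zeros : ∀ {n} {f : Fin n → ℕ} (ss : Vec Slot n) →
          Pointwise (λ s x → 0 ℕ.≤ x ⊎ a s ≤ ι x) ss (tabulate f)
        zeros []       = []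
        zeros (_ ∷ ss) = inj₁ z≤n ∷ zeros ss
      X-bounds (suc M) rewrite X-suc M = go (X-bounds M) (server-feasible M)
        where
        covered : ∀ s x z → M ℕ.≤ x ⊎ a s ≤ ι x → aᵢ s (suc M) ≤ ι z →
          suc M ℕ.≤ x ℕ.+ z ⊎ a s ≤ ι (x ℕ.+ z)
        covered s x z       (inj₂ a≤x) _ = inj₂ (≤-trans a≤x (ι-mono (ℕₚ.m≤m+n x z)))
        covered s x zero    (inj₁ M≤x) aᵢ≤0 =
          inj₂ (≤-trans (aᵢ≤0⇒a≤i s M aᵢ≤0) (ι-mono (ℕₚ.m≤n⇒m≤n+o 0 M≤x)))
        covered s x (suc z) (inj₁ M≤x) _ = inj₁ (ℕₚ.≤-trans (s≤s (ℕₚ.m≤n⇒m≤n+o z M≤x))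
          (ℕₚ.≤-reflexive (sym (ℕₚ.+-suc x z))))
        go : ∀ {n} {ss : Vec Slot n} {xs zs} →
          VecAll.All (ℕ._≤ M) xs × Pointwise (λ s x → M ℕ.≤ x ⊎ a s ≤ ι x) ss xs →
          Feasible (CPᵢ (suc M)) ss zs →
          VecAll.All (ℕ._≤ suc M) (Vec.zipWith ℕ._+_ xs zs) ×
          Pointwise (λ s x → suc M ℕ.≤ x ⊎ a s ≤ ι x) ss (Vec.zipWith ℕ._+_ xs zs)
        go (VecAll.[] , []) [] = VecAll.[] , []
        go {ss = s ∷ _} {x ∷ _} {z ∷ _} (x≤M VecAll.∷ xs≤M , c ∷ cs) ((z≤1 , aᵢ≤z) ∷ feasible)
          with ≤s , cs′ ← go (xs≤M , cs) feasible =
          ℕₚ.≤-trans (ℕₚ.+-mono-≤ x≤M z≤1) (ℕₚ.≤-reflexive (ℕₚ.+-comm M 1)) VecAll.∷ ≤s ,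
          covered s x z c aᵢ≤z ∷ cs′

      X-feasible : ∀ M → VecAll.All (λ s → a s ≤ ι M) ss → Feasible CP ss (X M)
      X-feasible M a≤M = go a≤M (proj₂ (X-bounds M))
        where
        go : ∀ {n} {ss : Vec Slot n} {xs} → VecAll.All (λ s → a s ≤ ι M) ss →
          Pointwise (λ s x → M ℕ.≤ x ⊎ a s ≤ ι x) ss xs → Feasible CP ss xs
        go VecAll.[]            []              = []
        go (a≤M VecAll.∷ as≤M) (inj₁ M≤x ∷ cs) = ≤-trans a≤M (ι-mono M≤x) ∷ go as≤M cs
        go (_ VecAll.∷ as≤M)   (inj₂ a≤x ∷ cs) = a≤x ∷ go as≤M cs

      -- The competitor is truncated at M as well, so that one induction step adds server M + 1 on
      -- the left and `above M` on the right.
      X-bound : ∀ M ys → Feasible CP ss ys →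
        cost β CP ss (X M) ≤ γ * cost β CP ss (Vec.map (M ℕ.⊓_) ys)
      X-bound zero ys feasible =
        -- With no servers both sides have the same baseline cost, the sum of p(t) d_t(0); it is
        -- nonnegative and γ ≥ 1.
        subst (λ xs → cost β CP ss (X 0) ≤ γ * cost β CP ss xs) X₀≡
          (≤-by (0≤κ ⊛ cost-nonNeg CP 0 ss (X 0) running-nonNeg)
            (solve 2 (λ k c → (:1 :+ k) :* c := c :+ k :* c) refl κ (cost β CP ss (X 0))))
        where
        X₀≡ : X 0 ≡ Vec.map (0 ℕ.⊓_) ys
        X₀≡ = trans (tabulate-∘ (λ _ → 0) (λ k → k)) (trans (map-const _ 0) (sym (map-const ys 0)))
        running-nonNeg : VecAll.All (λ s → ∀ x → 0# ≤ running CP s x) ss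
        running-nonNeg = VecAll.map (λ v x → 0≤p 0≤Pmin v ⊛ d-nonNeg v x) valid
      X-bound (suc M) ys feasible = ≤-trans
        (≤-trans (≤-reflexive (cong (cost β CP ss) (X-suc M)))
          (cost-add 0≤Pmin 0 0 ss (X M) zs valid (proj₁ (X-bounds M)) zs≤1))
        (≤-trans (+-mono-≤ (X-bound M ys feasible)
            (server-bound M (Vec.map (above M) ys) (above-feasible M feasible)))
          (≤-by ((0≤1 ⊕ 0≤κ) ⊛ ⟪ split ⟫)
            (solve 4 (λ g x y z → g :* z := g :* x :+ g :* y :+ g :* (z :- (x :+ y))) refl
              γ (cost β CP ss (Vec.map (M ℕ.⊓_) ys)) (cost β (CPᵢ (suc M)) ss (Vec.map (above M) ys))
              (cost β CP ss (Vec.map (suc M ℕ.⊓_) ys)))))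
        where
        zs = run w (GCSRₛ tail β (suc M)) ss
        zs≤1 : VecAll.All (ℕ._≤ 1) zs
        zs≤1 = go (server-feasible M)
          where
          go : ∀ {n} {ss : Vec Slot n} {zs} → Feasible (CPᵢ (suc M)) ss zs → VecAll.All (ℕ._≤ 1) zs
          go []                = VecAll.[]
          go ((z≤1 , _) ∷ f) = z≤1 VecAll.∷ go f
        split : cost β CP ss (Vec.map (M ℕ.⊓_) ys) + cost β (CPᵢ (suc M)) ss (Vec.map (above M) ys)
          ≤ cost β CP ss (Vec.map (suc M ℕ.⊓_) ys)
        split = subst₂ (λ u v → costFrom u β CP ss (Vec.map (M ℕ.⊓_) ys)
            + costFrom v β (CPᵢ (suc M)) ss (Vec.map (above M) ys)
              ≤ cost β CP ss (Vec.map (suc M ℕ.⊓_) ys))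
          (ℕₚ.⊓-zeroʳ M) (y≤M⇒above≡0 {M} z≤n) (cost-split M 0 ss ys)

      -- A server whose index exceeds the load revealed so far is still off, so summing up to the
      -- maximal load of the entire input changes nothing.
      total≡X : run w (GCSR tail β) ss ≡ X (maxLoad (toList ss))
      total≡X = tabulate-cong λ k → sym (sum-upTo-extend _ _ (maxLoad-take (suc (toℕ k) ℕ.+ w) (toList ss))
        (λ i → off i (suc (toℕ k)) (take (suc (toℕ k) ℕ.+ w) (toList ss))))
        where
        off : ∀ i t revealed → maxLoad revealed ℕ.≤ i → server (suc i) t revealed ≡ 0
        off i t revealed M≤i = steps-idle t 0# revealed (++⁺
          (ListAll.map (λ {s} a≤M b → <⇒≱ b (a≤i⇒aᵢ≤0 s i (≤-trans a≤M (ι-mono M≤i))))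
            (maxLoad-bound revealed))
          (toList⁺ (VecAll.map (λ a≤0 b → <⇒≱ b a≤0) (tail-idle i))))
          where open Server F tail β i

      total-bound : ∀ ys → Feasible CP ss ys →
        cost β CP ss (run w (GCSR tail β) ss) ≤ γ * cost β CP ss ys
      total-bound ys feasible = subst (λ xs → cost β CP ss xs ≤ γ * cost β CP ss ys) (sym total≡X)
        (≤-trans (X-bound M ys feasible) (*-monoˡ-≤-nonNeg (0≤1 ⊕ 0≤κ)
          (subst (λ x → costFrom x β CP ss (Vec.map (M ℕ.⊓_) ys) ≤ cost β CP ss ys) (ℕₚ.⊓-zeroʳ M)
            (cost-truncate CP M 0 ss ys
              (VecAll.map (λ v x → *-monoˡ-≤-nonNeg (0≤p 0≤Pmin v) (d-mono v (ℕₚ.m⊓n≤n M x))) valid)))))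
        where M = maxLoad (toList ss)

      total-feasible : Feasible CP ss (run w (GCSR tail β) ss)
      total-feasible = subst (Feasible CP ss) (sym total≡X)
        (X-feasible (maxLoad (toList ss)) (toList⁻ (maxLoad-bound (toList ss))))

    γ≡2-α : γ ≡ 2-α w π δ
    γ≡2-α = solve 1 (λ a → :1 :+ (:1 :- a) := :1 :+ :1 :- a) refl (α w π δ)

  GCSRₛ-achieves : GCSRₛ-Achieves-2-α w π
  GCSRₛ-achieves δ tail idle (suc j) _ ss ((valid , refl) , _) =
    server-feasible 0≤δ tail idle ss valid (dMin≤ ss) j ,
    λ ys (feasible , _) → ≤-trans
      (server-bound 0≤δ tail idle ss valid (dMin≤ ss) j ys feasible)
      (≤-reflexive (cong (_* cost β (CPᵢ (suc j)) ss ys) (γ≡2-α 0≤δ tail idle)))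
    where
    0≤δ = dMin-nonNeg ss valid

  GCSR-achieves : GCSR-Achieves-2-α w π
  GCSR-achieves δ tail idle ss (valid , refl) =
    total-feasible 0≤δ tail idle ss valid (dMin≤ ss) ,
    λ ys (feasible , _) → ≤-trans
      (total-bound 0≤δ tail idle ss valid (dMin≤ ss) ys feasible)
      (≤-reflexive (cong (_* cost β CP ss ys) (γ≡2-α 0≤δ tail idle)))
    where
    0≤δ = dMin-nonNeg ss valid

-- Inputs with linear power consumption

module LinearSlots {c ℓ} (F : ArchimedeanOrderedField c ℓ) where

  open OrderedField F
  open Provisioning F

  -- All servers have the same increment σ and workload does not influence power, so an idling
  -- server costs p σ in CP and in every CPᵢ alike.
  linear : (load price slope : Carrier) → Slot
  linear a p σ = slot a p (λ x _ → σ * ι x)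

  -- A problem in which slots with load ι i require one server and never more
  -- than one, as CPᵢ and, for i = 1, CP do.
  record Linear (P : Problem) (i : ℕ) : Set (c Level.⊔ ℓ) where
    field
      running-linear : ∀ a p σ x → running P (linear a p σ) x ≡ p * σ * ι x
      busy⇒on        : ∀ p σ {x} → Admissible P (linear (ι i) p σ) x → 1 ℕ.≤ x
      busy-on        : ∀ p σ → Admissible P (linear (ι i) p σ) 1
      idle-≤1        : ∀ p σ {x} → x ℕ.≤ 1 → Admissible P (linear 0# p σ) x

  CP-linear : Linear CP 1
  CP-linear = record
    { running-linear = λ a p σ x → solve 3 (λ p σ x → p :* (σ :* x) := p :* σ :* x) refl p σ (ι x)
    ; busy⇒on        = λ _ _ → ι-cancel-≤
    ; busy-on        = λ _ _ → ≤-refl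
    ; idle-≤1        = λ _ _ {x} _ → ι-nonNeg x
    }

  CPᵢ-linear : ∀ j → Linear (CPᵢ (suc j)) (suc j)
  CPᵢ-linear j = record
    { running-linear = λ a p σ x →
        solve 4 (λ p σ j x → p :* (σ :* (:1 :+ j) :- σ :* j) :* x := p :* σ :* x) refl p σ (ι j) (ι x)
    ; busy⇒on        = λ { p σ {zero}  (_ , aᵢ≤0) → contradiction
                             (aᵢ≤0⇒a≤i (linear (ι (suc j)) p σ) j aᵢ≤0) (ι-suc≰ j)
                         ; p σ {suc _} _ → s≤s z≤n }
    ; busy-on        = λ p σ → ℕₚ.≤-refl ,
        ≤-trans (aᵢ≤1 (linear (ι (suc j)) p σ) (suc j)) (≤-reflexive (sym ι1))
    ; idle-≤1        = λ p σ {x} x≤1 → x≤1 ,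
        ≤-trans (a≤i⇒aᵢ≤0 (linear 0# p σ) j (ι-nonNeg j)) (ι-nonNeg x)
    }
    where open SlotProperties F

  linear-valid : ∀ {Pmin Pmax a p σ} → 0# ≤ a → Pmin ≤ p → p ≤ Pmax → 0# ≤ σ →
    Valid Pmin Pmax (linear a p σ)
  linear-valid {σ = σ} 0≤a Pmin≤p p≤Pmax 0≤σ = record
    { a-nonNeg   = 0≤a
    ; p-lower    = Pmin≤p
    ; p-upper    = p≤Pmax
    ; g-nonNeg   = λ x _ → 0≤σ ⊛ ι-nonNeg x
    ; g-mono-x   = λ x _ → *-monoˡ-≤-nonNeg 0≤σ (ι-mono (ℕₚ.n≤1+n x))
    ; g-mono-a   = λ _ _ _ → ≤-refl
    ; g-convex-x = λ x _ → ≤-reflexive (solve 2 (λ σ x →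
        σ :* (:1 :+ x) :- σ :* x := σ :* (:1 :+ (:1 :+ x)) :- σ :* (:1 :+ x)) refl σ (ι x))
    ; g-convex-a = λ { x {λ′ = λ′} _ _ _ _ → ≤-reflexive (solve 2 (λ y l →
        y := l :* y :+ (:1 :- l) :* y) refl (σ * ι x) λ′) }
    }

  linear-slope : ∀ a p σ → d (linear a p σ) 1 - d (linear a p σ) 0 ≡ σ
  linear-slope a p σ = solve 1 (λ σ → σ :* (:1 :+ :0) :- σ :* :0 := σ) refl σ


-- Existence of optimal solutions

module _ {c ℓ} (F : ArchimedeanOrderedField c ℓ) where

  open OrderedField F

  module Optimum {β : Carrier} (0≤β : 0# ≤ β) (P : Provisioning.Problem F) where

    open Provisioning F
    open CostDecomposition F 0≤β

    private
      -- Backward recursion over the two decisions. Decidable admissibility of 0 and totality of the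
      -- order make the choice constructive; competing decisions count only up to 1.
      best : ∀ {n} (ss : Vec Slot n) →
        VecAll.All (λ s → Admissible P s 1 × Dec (Admissible P s 0)) ss → ∀ x₀ →
        ∃ λ y → Feasible P ss y × ∀ z → Feasible P ss z →
          costFrom x₀ β P ss y ≤ costFrom x₀ β P ss (Vec.map (1 ℕ.⊓_) z)
      best []       _ x₀ = [] , [] , λ { [] _ → ≤-refl }
      best (s ∷ ss) ((adm₁ , adm₀?) VecAll.∷ adms) x₀
        with best ss adms 0 | best ss adms 1
      ... | y₀ , feasible₀ , min₀ | y₁ , feasible₁ , min₁ = choose adm₀?
        where
        c₀ c₁ : Carrier
        c₀ = costFrom x₀ β P (s ∷ ss) (0 ∷ y₀)
        c₁ = costFrom x₀ β P (s ∷ ss) (1 ∷ y₁)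

        choose : Dec (Admissible P s 0) → ∃ λ y → Feasible P (s ∷ ss) y × ∀ z → Feasible P (s ∷ ss) z →
          costFrom x₀ β P (s ∷ ss) y ≤ costFrom x₀ β P (s ∷ ss) (Vec.map (1 ℕ.⊓_) z)
        choose (no ¬adm₀) = 1 ∷ y₁ , adm₁ ∷ feasible₁ , λ where
          (zero  ∷ z) (adm₀ ∷ _)     → contradiction adm₀ ¬adm₀
          (suc _ ∷ z) (_ ∷ feasible) → +-monoʳ-≤ _ (min₁ z feasible)
        choose (yes adm₀) with total c₀ c₁
        ... | inj₁ c₀≤c₁ = 0 ∷ y₀ , adm₀ ∷ feasible₀ , λ where
          (zero  ∷ z) (_ ∷ feasible) → +-monoʳ-≤ _ (min₀ z feasible)
          (suc _ ∷ z) (_ ∷ feasible) → ≤-trans c₀≤c₁ (+-monoʳ-≤ _ (min₁ z feasible))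
        ... | inj₂ c₁≤c₀ = 1 ∷ y₁ , adm₁ ∷ feasible₁ , λ where
          (zero  ∷ z) (_ ∷ feasible) → ≤-trans c₁≤c₀ (+-monoʳ-≤ _ (min₀ z feasible))
          (suc _ ∷ z) (_ ∷ feasible) → +-monoʳ-≤ _ (min₁ z feasible)

    optimum : ∀ {n} (ss : Vec Slot n) →
      VecAll.All (λ s → Admissible P s 1 × Dec (Admissible P s 0)) ss →
      VecAll.All (λ s → ∀ x → running P s (1 ℕ.⊓ x) ≤ running P s x) ss →
      ∃ (Optimal β P ss)
    optimum ss adms mono with y , feasible , min ← best ss adms 0 =
      y , feasible , λ z feasible′ → ≤-trans (min z feasible′) (cost-truncate P 1 0 ss z mono)


-- The adversary

module _ {c ℓ} (F : ArchimedeanOrderedField c ℓ) where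

  open OrderedField F
  open LinearSlots F

  module Adversary {β : Carrier} (0<β : 0# < β) (w : ℕ) (A : Provisioning.Online F)
    {P : Provisioning.Problem F} {i : ℕ} (linear-P : Linear P i)
    (price slope : Carrier) (0<e : 0# < price * slope) where

    open Provisioning F
    open Linear linear-P

    private
      e = price * slope
      0≤e = proj₁ 0<e
      0≤β = proj₁ 0<β
      B = linear (ι i) price slope
      I = linear 0# price slope

    costFrom-1≤0 : ∀ {n} (ss : Vec Slot n) ys → costFrom 1 β P ss ys ≤ costFrom 0 β P ss ys
    costFrom-1≤0 []       []       = ≤-refl
    costFrom-1≤0 (s ∷ ss) (y ∷ ys) =
      +-mono-≤ (+-monoʳ-≤ _ (*-monoˡ-≤-nonNeg 0≤β ([]⁺-mono (≤-by 0≤1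
        (solve 1 (λ y → y :- :0 := y :- (:1 :+ :0) :+ :1) refl (ι y)))))) ≤-refl

    costFrom-0≤1+β : ∀ {n} (ss : Vec Slot n) ys → costFrom 0 β P ss ys ≤ costFrom 1 β P ss ys + β
    costFrom-0≤1+β []       []       = ≤-by 0≤β (solve 1 (λ b → :0 :+ b := :0 :+ b) refl β)
    costFrom-0≤1+β (s ∷ ss) (y ∷ ys) = ≤-by (0≤β ⊛ ⟪ [y-0]⁺≤ ⟫)
      (solve 5 (λ r b u v V → r :+ b :* u :+ V :+ b
          := r :+ b :* v :+ V :+ b :* (u :+ :1 :- v))
        refl (running P s y) β [ ι y - ι 1 ]⁺ [ ι y - ι 0 ]⁺ (costFrom y β P ss ys))
      where
      [y-0]⁺≤ : [ ι y - ι 0 ]⁺ ≤ [ ι y - ι 1 ]⁺ + 1#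
      [y-0]⁺≤ = []⁺-lub (0≤[ ι y - ι 1 ]⁺ ⊕ 0≤1) (≤-by ⟪ ≤[ ι y - ι 1 ]⁺ ⟫
        (solve 2 (λ y u → u :+ :1 := y :- :0 :+ (u :- (y :- (:1 :+ :0)))) refl (ι y) [ ι y - ι 1 ]⁺))

    -- Here t counts from 0 and `full` is the entire input: decisions depend on all of it up to the
    -- look-ahead, even while the cost is computed along a suffix.
    decision : List Slot → ℕ → ℕ
    decision full t = A (suc t) (take (suc t ℕ.+ w) full)

    decisions : List Slot → ℕ → ∀ n → Vec ℕ n
    decisions full t zero    = []
    decisions full t (suc n) = decision full t ∷ decisions full (suc t) n

    run≡decisions : ∀ {n} (ss : Vec Slot n) → run w A ss ≡ decisions (toList ss) 0 n
    run≡decisions ss = go _ 0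
      where
      go : ∀ n t → tabulate {n = n} (λ k → decision (toList ss) (t ℕ.+ toℕ k))
        ≡ decisions (toList ss) t n
      go zero    t = refl
      go (suc n) t = cong₂ _∷_
        (cong (decision (toList ss)) (ℕₚ.+-identityʳ t))
        (trans (tabulate-cong λ k → cong (decision (toList ss)) (ℕₚ.+-suc t (toℕ k)))
          (go n (suc t)))

    -- The switching cost already paid for the server that is on.
    φ : ℕ → Carrier
    φ zero    = 0#
    φ (suc _) = β

    -- In CP the online algorithm may run several servers. Crediting just one of them keeps this
    -- amortised inequality valid for all counts.
    φ-step : ∀ x₀ x → φ x ≤ β * [ ι x - ι x₀ ]⁺ + φ x₀
    φ-step zero    zero    = 0≤β ⊛ 0≤[ ι 0 - ι 0 ]⁺ ⊕ ≤-refl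
    φ-step (suc y) zero    = 0≤β ⊛ 0≤[ ι 0 - ι (suc y) ]⁺ ⊕ 0≤β
    φ-step zero    (suc x) = ≤-by (0≤β ⊛ (⟪ ≤[ ι (suc x) - ι 0 ]⁺ ⟫ ⊕ ι-nonNeg x))
      (solve 3 (λ b u x → b :* u :+ :0 := b :+ b :* (u :- (:1 :+ x :- :0) :+ x)) refl
        β [ ι (suc x) - ι 0 ]⁺ (ι x))
    φ-step (suc y) (suc x) = ≤-by (0≤β ⊛ 0≤[ ι (suc x) - ι (suc y) ]⁺)
      (solve 2 (λ b u → b :* u :+ b := b :+ b :* u) refl β [ ι (suc x) - ι (suc y) ]⁺)

    running-nonNeg : ∀ a x → 0# ≤ running P (linear a price slope) x
    running-nonNeg a x = subst (0# ≤_) (sym (running-linear a price slope x)) (0≤e ⊛ ι-nonNeg x)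

    e≤running : ∀ a {x} → 1 ℕ.≤ x → e ≤ running P (linear a price slope) x
    e≤running a {x} 1≤x = subst (e ≤_) (sym (running-linear a price slope x))
      (≤-by (0≤e ⊛ ⟪ ι-mono 1≤x ⟫)
        (solve 2 (λ e x → e :* x := e :+ e :* (x :- (:1 :+ :0))) refl e (ι x)))

    -- T is the offline cost, up to a constant, and N / (β + e) the ratio forced on
    -- the online algorithm, which pays at least β + (k + 1)e for a round whose gap
    -- it leaves after k idle slots; the workload returns w + 1 slots later.
    record Outcome (N : Carrier) (history : List Slot) (n : ℕ) : Set (c Level.⊔ ℓ) where
      field
        {size}  : ℕ
        slots   : Vec Slot size
        shape   : VecAll.All (λ s → s ≡ B ⊎ s ≡ I) slots
        load    : i ℕ.≤ maxLoad (toList slots)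
        T       : Carrier
        ne≤T    : ι n * e ≤ T
        online  : ∀ full t → full ≡ history ++ toList slots → t ≡ length history →
          Feasible P slots (decisions full t size) → ∀ x₀ →
          N * T ≤ (β + e) * (costFrom x₀ β P slots (decisions full t size) + φ x₀)
        offline : ∃ λ ys → Feasible P slots ys × costFrom 1 β P slots ys ≤ T

    module Game (N : Carrier) (N-small : N ≤ β ⊎ N + ι w * e ≤ β + β)
      (f : ℕ) (2β≤fe : β + β ≤ ι f * e) where

      N≤2β : N ≤ β + β
      N≤2β = reduce (Sum.map from-β from-2β N-small)
        where
        from-β : N ≤ β → N ≤ β + β
        from-β N≤β = ≤-by (⟪ N≤β ⟫ ⊕ 0≤β)
          (solve 2 (λ b n → b :+ b := n :+ (b :- n :+ b)) refl β N)
        from-2β : N + ι w * e ≤ β + β → N ≤ β + β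
        from-2β N+we≤2β = ≤-by (⟪ N+we≤2β ⟫ ⊕ (ι-nonNeg w ⊛ 0≤e))
          (solve 3 (λ b n u → b :+ b := n :+ (b :+ b :- (n :+ u) :+ u)) refl β N (ι w * e))

      -- This compares the offline cost e + μ of a round with the online cost q + e, denominators
      -- cleared. If N ≤ β, then q ≥ β suffices; if the algorithm never switched off, q ≥ 2β does.
      -- The remaining case, N ≤ 2β - we, is where the window matters.
      round-ratio : ∀ j q → (∃ λ k → j ≡ k ℕ.+ suc w × q ≡ β + ι k * e) ⊎ q ≡ ι f * e →
        N * (e + min β (ι j * e)) ≤ (β + e) * (q + e)
      round-ratio j q charge = go N-small charge
        where
        μ = min β (ι j * e)
        0≤μ : 0# ≤ μ
        0≤μ = min-glb 0≤β (ι-nonNeg j ⊛ 0≤e)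

        N-bound : ∀ {D} → N ≤ D → N * (e + μ) ≤ D * (e + μ)
        N-bound = *-monoʳ-≤-nonNeg (0≤e ⊕ 0≤μ)

        at-least-β : N ≤ β → β ≤ q → N * (e + μ) ≤ (β + e) * (q + e)
        at-least-β N≤β β≤q = ≤-trans (N-bound N≤β)
          (≤-by (0≤β ⊛ ⟪ min≤x β _ ⟫ ⊕ (0≤β ⊕ 0≤e) ⊛ ⟪ β≤q ⟫ ⊕ 0≤e ⊛ (0≤β ⊕ 0≤e))
            (solve 4 (λ b e u q → (b :+ e) :* (q :+ e) := b :* (e :+ u)
                :+ (b :* (b :- u) :+ (b :+ e) :* (q :- b) :+ e :* (b :+ e)))
              refl β e μ q))

        go : N ≤ β ⊎ N + ι w * e ≤ β + β → (∃ λ k → j ≡ k ℕ.+ suc w × q ≡ β + ι k * e) ⊎ q ≡ ι f * e →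
          N * (e + μ) ≤ (β + e) * (q + e)
        go _ (inj₂ refl) = ≤-trans (N-bound N≤2β)
          (≤-by ((0≤β ⊕ 0≤β) ⊛ ⟪ min≤x β _ ⟫ ⊕ (0≤β ⊕ 0≤e) ⊛ ⟪ 2β≤fe ⟫ ⊕ 0≤e ⊛ (0≤β ⊕ 0≤e))
            (solve 4 (λ b e u q → (b :+ e) :* (q :+ e) := (b :+ b) :* (e :+ u)
                :+ ((b :+ b) :* (b :- u) :+ (b :+ e) :* (q :- (b :+ b)) :+ e :* (b :+ e)))
              refl β e μ q))
        go (inj₁ N≤β) (inj₁ (k , refl , refl)) = at-least-β N≤β (≤-by (ι-nonNeg k ⊛ 0≤e) refl)
        go (inj₂ N+we≤2β) (inj₁ (k , refl , refl)) with ι w * e ≤? β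
        ... | no we≰β = at-least-β (≤-by (⟪ N+we≤2β ⟫ ⊕ ⟪ ≰⇒≥ we≰β ⟫)
                (solve 3 (λ n u b → b := n :+ (b :+ b :- (n :+ u) :+ (u :- b))) refl N (ι w * e) β))
              (≤-by (ι-nonNeg k ⊛ 0≤e) refl)
        ... | yes we≤β = ≤-trans (N-bound N≤D) (gap (total β (ι j * e)))
          where
          D : Carrier
          D = β + β - ι w * e
          N≤D : N ≤ D
          N≤D = ≤-by ⟪ N+we≤2β ⟫
            (solve 3 (λ n u b → b :+ b :- u := n :+ (b :+ b :- (n :+ u))) refl N (ι w * e) β)
          0≤D : 0# ≤ D
          0≤D = ≤-trans (0≤β ⊕ ⟪ we≤β ⟫)
            (≤-reflexive (solve 2 (λ u b → b :+ (b :- u) := b :+ b :- u) refl (ι w * e) β))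
          s : Carrier
          s = ι (k ℕ.+ suc w) * e
          s≡ : s ≡ (ι k + (1# + ι w)) * e
          s≡ = cong (_* e) (ι-+ k (suc w))
          gap : β ≤ s ⊎ s ≤ β → D * (e + μ) ≤ (β + e) * (q + e)
          -- Here leaving is the offline choice, and D ≤ β + (k + 1)e is the same as β ≤ s.
          gap (inj₁ β≤s) = ≤-by (0≤D ⊛ ⟪ min≤x β _ ⟫ ⊕ (0≤β ⊕ 0≤e) ⊛ ⟪ subst (β ≤_) s≡ β≤s ⟫)
            (solve 5 (λ b e u k w → (b :+ e) :* (b :+ k :* e :+ e)
                := (b :+ b :- w :* e) :* (e :+ u) :+ ((b :+ b :- w :* e) :* (b :- u)
                  :+ (b :+ e) :* ((k :+ (:1 :+ w)) :* e :- b)))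
              refl β e μ (ι k) (ι w))
          -- At μ = s the two sides differ by (β - s)(β - s + ke), so the worst gap costs exactly β.
          gap (inj₂ s≤β) = ≤-by
            (0≤D ⊛ ⟪ subst (μ ≤_) s≡ (min≤y β s) ⟫ ⊕ 0≤β-s ⊛ (0≤β-s ⊕ ι-nonNeg k ⊛ 0≤e))
            (solve 5 (λ b e u k w → (b :+ e) :* (b :+ k :* e :+ e)
                := (b :+ b :- w :* e) :* (e :+ u) :+ ((b :+ b :- w :* e) :* ((k :+ (:1 :+ w)) :* e :- u)
                  :+ (b :- (k :+ (:1 :+ w)) :* e) :* (b :- (k :+ (:1 :+ w)) :* e :+ k :* e)))
              refl β e μ (ι k) (ι w))
            where
            0≤β-s : 0# ≤ β - (ι k + (1# + ι w)) * e
            0≤β-s = ⟪ subst (_≤ β) s≡ s≤β ⟫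

      idles : ∀ j {n} → Vec Slot n → Vec Slot (j ℕ.+ n)
      idles j ss = Vec.replicate j I Vec.++ ss

      -- `q` is the online cost charged to the gap of `j` idle slots; after a switch-off its summand
      -- β is the credit φ given up. `past` is tied to the history by an equation, so that `gap` can
      -- move an idle slot from the history into the gap without transporting `outcome`.
      record GapOutcome (history : List Slot) (fuel n : ℕ) : Set (c Level.⊔ ℓ) where
        field
          j       : ℕ
          w≤j     : w ℕ.≤ j
          {past}  : List Slot
          past≡   : past ≡ history ++ List.replicate j I
          outcome : Outcome N past n
          q       : Carrier
          charge  : (∃ λ k → j ≡ k ℕ.+ suc w × q ≡ β + ι k * e) ⊎ q ≡ ι fuel * e

        open Outcome outcome public

        field
          online-gap : ∀ full t →
            full ≡ history ++ (List.replicate j I ++ toList slots) → t ≡ length history →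
            Feasible P (idles j slots) (decisions full t (j ℕ.+ size)) → ∀ x₀ → 1 ℕ.≤ x₀ →
            N * T + (β + e) * q
              ≤ (β + e) * (costFrom x₀ β P (idles j slots) (decisions full t (j ℕ.+ size)) + β)

      private
        0≤β+e : 0# ≤ β + e
        0≤β+e = 0≤β ⊕ 0≤e

        credit : ∀ {x₀ x r V b} → 0# ≤ r → b ≤ (β + e) * (V + φ x) →
          b ≤ (β + e) * (r + β * [ ι x - ι x₀ ]⁺ + V + φ x₀)
        credit {x₀} {x} {r} {V} {b} 0≤r b≤ = ≤-by (⟪ b≤ ⟫ ⊕ 0≤β+e ⊛ (0≤r ⊕ ⟪ φ-step x₀ x ⟫))
          (solve 7 (λ k r u V f f₀ b → k :* (r :+ u :+ V :+ f₀)
              := b :+ (k :* (V :+ f) :- b :+ k :* (r :+ (u :+ f₀ :- f))))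
            refl (β + e) r (β * [ ι x - ι x₀ ]⁺) V (φ x) (φ x₀) b)

        -- Idle slots that were already shown have to be waited out. Whatever the algorithm does in
        -- them, it cannot gain: running costs are nonnegative and switching costs cover any rise of
        -- φ.
        idle-run : ∀ j {n b} (L : Vec Slot n) full t →
          (∀ x₀ → Feasible P L (decisions full (j ℕ.+ t) n) →
            b ≤ (β + e) * (costFrom x₀ β P L (decisions full (j ℕ.+ t) n) + φ x₀)) →
          Feasible P (idles j L) (decisions full t (j ℕ.+ n)) → ∀ x₀ →
          b ≤ (β + e) * (costFrom x₀ β P (idles j L) (decisions full t (j ℕ.+ n)) + φ x₀)
        idle-run zero    L full t rest feasible       x₀ = rest x₀ feasible
        idle-run (suc j) {n} {b} L full t rest (_ ∷ feasible) x₀ =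
          credit {x₀} {decision full t} (running-nonNeg 0# (decision full t))
            (idle-run j L full (suc t)
              (subst (λ t → ∀ x₀ → Feasible P L (decisions full t n) →
                  b ≤ (β + e) * (costFrom x₀ β P L (decisions full t n) + φ x₀))
                (sym (ℕₚ.+-suc j t)) rest)
              feasible (decision full t))

        φ-pos : ∀ {x} → 1 ℕ.≤ x → φ x ≡ β
        φ-pos (s≤s _) = refl

        take-idles : ∀ {k j} → k ℕ.≤ j → (L : List Slot) →
          take k (List.replicate j I ++ L) ≡ List.replicate k I
        take-idles z≤n       L = refl
        take-idles (s≤s k≤j) L = cong (I ∷_) (take-idles k≤j L)

        take-length+ : ∀ (L M : List Slot) k → take (length L ℕ.+ k) (L ++ M) ≡ L ++ take k M
        take-length+ []      M k = refl
        take-length+ (s ∷ L) M k = cong (s ∷_) (take-length+ L M k)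

        -- The answer to a query is the decision in the finished input too, because the look-ahead
        -- sees w + 1 slots and at least as many idle ones are delivered.
        revealed : ∀ {history j L full t} → w ℕ.≤ j →
          full ≡ history ++ (List.replicate (suc j) I ++ L) →
          t ≡ length history →
          decision full t ≡ A (suc (length history)) (history ++ List.replicate (suc w) I)
        revealed {history} {j} {L} w≤j refl refl = cong (A (suc (length history)))
          (trans (cong (λ k → take k (history ++ (List.replicate (suc j) I ++ L)))
              (sym (ℕₚ.+-suc (length history) w)))
            (trans (take-length+ history _ (suc w)) (cong (history ++_) (take-idles (s≤s w≤j) L))))

        +-length : ∀ j (history : List Slot) → j ℕ.+ length history ≡ length (history ++ List.replicate j I)
        +-length j history = trans (ℕₚ.+-comm j (length history))
          (sym (trans (length-++ history) (cong (length history ℕ.+_) (length-replicate j))))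

        suc-length : ∀ s (history : List Slot) → suc (length history) ≡ length (history List.∷ʳ s)
        suc-length s history = trans (ℕₚ.+-comm 1 (length history)) (sym (length-++ history))

      -- Each unit of fuel is one query. The answer 0 ends the gap, any other answer costs the
      -- algorithm e; the fuel bounds the length of the gap for an algorithm that never switches
      -- off.
      gap : ∀ {n} → (∀ history → Outcome N history n) → ∀ history fuel → GapOutcome history fuel n
      -- The query before this one showed w idle slots beyond its own, which still have to come.
      gap {n} next history zero = record
        { j = w ; w≤j = ℕₚ.≤-refl ; past≡ = refl ; outcome = o ; q = ι 0 * e ; charge = inj₂ refl
        ; online-gap = λ { full t full≡ refl feasible x₀ 1≤x₀ → ≤-trans
            (≤-reflexive (solve 3 (λ v b e → v :+ (b :+ e) :* (:0 :* e) := v) refl (N * T) β e))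
            (≤-trans
              (idle-run w slots full t (λ x₁ feasible → online full (w ℕ.+ t)
                (trans full≡ (sym (++-assoc history _ _))) (+-length w history) feasible x₁) feasible x₀)
              (≤-reflexive (cong (λ b → (β + e) * (costFrom x₀ β P (idles w slots)
                  (decisions full t (w ℕ.+ size)) + b)) (φ-pos 1≤x₀)))) }
        }
        where
        o : Outcome N (history ++ List.replicate w I) n
        o = next (history ++ List.replicate w I)
        open Outcome o
      gap {n} next history (suc fuel)
        with A (suc (length history)) (history ++ List.replicate (suc w) I) in now
      -- The current slot and the w slots in view when the answer was given are idle; workload
      -- returns right after them.
      ... | zero = record
        { j = suc w ; w≤j = ℕₚ.n≤1+n w ; past≡ = refl ; outcome = o ; q = β + ι 0 * e
        ; charge = inj₁ (0 , refl , refl)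
        ; online-gap = λ { full t full≡ refl (_ ∷ feasible) x₀ _ →
            off x₀ (decision full t) (trans (revealed ℕₚ.≤-refl full≡ refl) now)
              (running-nonNeg 0# (decision full t))
              (idle-run w slots full (suc t) (λ x₁ feasible → online full (w ℕ.+ suc t)
                (trans full≡ (sym (++-assoc history _ _)))
                (trans (ℕₚ.+-suc w t) (+-length (suc w) history)) feasible x₁) feasible _) }
        }
        where
        o : Outcome N (history ++ List.replicate (suc w) I) n
        o = next (history ++ List.replicate (suc w) I)
        open Outcome o
        off : ∀ x₀ x {r V b} → x ≡ 0 → 0# ≤ r → b ≤ (β + e) * (V + φ x) →
          b + (β + e) * (β + ι 0 * e) ≤ (β + e) * (r + β * [ ι x - ι x₀ ]⁺ + V + β)
        off x₀ x {r} {V} {b} refl 0≤r b≤ = ≤-by (⟪ b≤ ⟫ ⊕ 0≤β+e ⊛ (0≤r ⊕ 0≤β ⊛ 0≤[ ι x - ι x₀ ]⁺))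
          (solve 6 (λ b₀ e r u V b → (b₀ :+ e) :* (r :+ u :+ V :+ b₀)
              := b :+ (b₀ :+ e) :* (b₀ :+ :0 :* e)
                :+ ((b₀ :+ e) :* (V :+ :0) :- b :+ (b₀ :+ e) :* (r :+ u)))
            refl β e r (β * [ ι x - ι x₀ ]⁺) V b)
      ... | suc x′ = record
        { j = suc j ; w≤j = ℕₚ.m≤n⇒m≤1+n w≤j
        ; past≡ = trans past≡ (∷ʳ-++ history I (List.replicate j I)) ; outcome = outcome ; q = e + q
        ; charge = Sum.map
            (λ (k , j≡ , q≡) → suc k , cong suc j≡ , trans (cong (e +_) q≡)
              (solve 3 (λ b e k → e :+ (b :+ k :* e) := b :+ (:1 :+ k) :* e) refl β e (ι k)))
            (λ q≡ → trans (cong (e +_) q≡)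
              (solve 2 (λ e k → e :+ k :* e := (:1 :+ k) :* e) refl e (ι fuel)))
            charge
        ; online-gap = λ { full t full≡ refl (_ ∷ feasible) x₀ _ →
            let 1≤x = ℕₚ.≤-trans (s≤s (z≤n {x′}))
                  (ℕₚ.≤-reflexive (sym (trans (revealed w≤j full≡ refl) now)))
            in on x₀ (decision full t) (e≤running 0# 1≤x)
              (online-gap full (suc t) (trans full≡ (sym (∷ʳ-++ history I _))) (suc-length I history)
                feasible _ 1≤x) }
        }
        where
        open GapOutcome (gap next (history List.∷ʳ I) fuel)
        on : ∀ x₀ x {r V b} → e ≤ r → b + (β + e) * q ≤ (β + e) * (V + β) →
          b + (β + e) * (e + q) ≤ (β + e) * (r + β * [ ι x - ι x₀ ]⁺ + V + β)
        on x₀ x {r} {V} {b} e≤r b≤ = ≤-by (⟪ b≤ ⟫ ⊕ 0≤β+e ⊛ (⟪ e≤r ⟫ ⊕ 0≤β ⊛ 0≤[ ι x - ι x₀ ]⁺))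
          (solve 7 (λ b₀ e r u V b q → (b₀ :+ e) :* (r :+ u :+ V :+ b₀)
              := b :+ (b₀ :+ e) :* (e :+ q)
                :+ ((b₀ :+ e) :* (V :+ b₀) :- (b :+ (b₀ :+ e) :* q) :+ (b₀ :+ e) :* (r :- e :+ u)))
            refl β e r (β * [ ι x - ι x₀ ]⁺) V b q)

      private
        toList-idles : ∀ j {n} (ss : Vec Slot n) → toList (idles j ss) ≡ List.replicate j I ++ toList ss
        toList-idles zero    ss = refl
        toList-idles (suc j) ss = cong (I ∷_) (toList-idles j ss)

        shape-idles : ∀ j {n} {ss : Vec Slot n} →
          VecAll.All (λ s → s ≡ B ⊎ s ≡ I) ss → VecAll.All (λ s → s ≡ B ⊎ s ≡ I) (idles j ss)
        shape-idles zero    shape = shape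
        shape-idles (suc j) shape = inj₂ refl VecAll.∷ shape-idles j shape

        feasible-idles : ∀ j {x n} {ss : Vec Slot n} {ys} → x ℕ.≤ 1 → Feasible P ss ys →
          Feasible P (idles j ss) (Vec.replicate j x Vec.++ ys)
        feasible-idles zero    x≤1 feasible = feasible
        feasible-idles (suc j) x≤1 feasible = idle-≤1 price slope x≤1 ∷ feasible-idles j x≤1 feasible

        on-cost : ∀ a {n} (ss : Vec Slot n) ys →
          costFrom 1 β P (linear a price slope ∷ ss) (1 ∷ ys) ≡ e + costFrom 1 β P ss ys
        on-cost a ss ys rewrite running-linear a price slope 1 | ι-decrease (s≤s (z≤n {0})) =
          solve 3 (λ e b V → e :* (:1 :+ :0) :+ b :* :0 :+ V := e :+ V) refl e β (costFrom 1 β P ss ys)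

        stay-cost : ∀ j {n} (ss : Vec Slot n) ys →
          costFrom 1 β P (idles j ss) (Vec.replicate j 1 Vec.++ ys) ≡ ι j * e + costFrom 1 β P ss ys
        stay-cost zero    ss ys = solve 2 (λ e V → V := :0 :* e :+ V) refl e (costFrom 1 β P ss ys)
        stay-cost (suc j) ss ys = trans (on-cost 0# (idles j ss) _) (trans (cong (e +_) (stay-cost j ss ys))
          (solve 3 (λ e j V → e :+ (j :* e :+ V) := (:1 :+ j) :* e :+ V) refl e (ι j) (costFrom 1 β P ss ys)))

        leave-cost : ∀ j {n} (ss : Vec Slot n) ys x → x ℕ.≤ 1 →
          costFrom x β P (idles j ss) (Vec.replicate j 0 Vec.++ ys) ≤ costFrom 0 β P ss ys
        leave-cost zero    ss ys zero       _ = ≤-refl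
        leave-cost zero    ss ys (suc zero) _ = costFrom-1≤0 ss ys
        leave-cost zero    ss ys (suc (suc _)) (s≤s ())
        leave-cost (suc j) ss ys x _ rewrite running-linear 0# price slope 0 | ι-decrease (z≤n {x}) =
          ≤-trans (≤-reflexive (solve 3 (λ e b V → e :* :0 :+ b :* :0 :+ V := V) refl e β _))
            (leave-cost j ss ys 0 z≤n)

        busy-step : ∀ x₀ {x} → 1 ℕ.≤ x → e + β ≤ running P B x + β * [ ι x - ι x₀ ]⁺ + φ x₀
        busy-step x₀ {x} 1≤x = ≤-by
          (⟪ e≤running (ι i) 1≤x ⟫ ⊕ ⟪ subst (_≤ β * [ ι x - ι x₀ ]⁺ + φ x₀) (φ-pos 1≤x) (φ-step x₀ x) ⟫)
          (solve 5 (λ e b r u f → r :+ u :+ f := e :+ b :+ (r :- e :+ (u :+ f :- b))) refl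
            e β (running P B x) (β * [ ι x - ι x₀ ]⁺) (φ x₀))

        load-head : ∀ {n} (ss : Vec Slot n) → i ℕ.≤ maxLoad (toList (B ∷ ss))
        load-head ss = ℕₚ.≤-trans (ι-cancel-≤ (x≤⌈x⌉ (ι i))) (ℕₚ.m≤m⊔n ⌈ ι i ⌉ _)

      -- A final slot with workload closes the last gap and makes the algorithm return. Here N e ≤
      -- 2βe ≤ (β + e)² is enough.
      lastRound : ∀ history → Outcome N history 0
      lastRound history = record
        { slots   = B ∷ []
        ; shape   = inj₁ refl VecAll.∷ VecAll.[]
        ; load    = load-head []
        ; T       = e
        ; ne≤T    = ≤-by 0≤e (solve 1 (λ e → e := :0 :* e :+ e) refl e)
        ; online  = λ { full t _ _ (adm ∷ []) x₀ →
            ≤-by (⟪ N≤2β ⟫ ⊛ 0≤e ⊕ 0≤β ⊛ 0≤β ⊕ 0≤e ⊛ 0≤e ⊕ 0≤β+e ⊛ ⟪ busy-step x₀ (busy⇒on price slope adm) ⟫)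
              (solve 6 (λ n b e r u f → (b :+ e) :* (r :+ u :+ :0 :+ f)
                  := n :* e :+ ((b :+ b :- n) :* e :+ b :* b :+ e :* e :+ (b :+ e) :* (r :+ u :+ f :- (e :+ b))))
                refl N β e (running P B (decision full t)) (β * [ ι (decision full t) - ι x₀ ]⁺) (φ x₀)) }
        ; offline = 1 ∷ [] , busy-on price slope ∷ [] , ≤-reflexive (trans (on-cost (ι i) [] []) (+-identityʳ e))
        }

      round : ∀ {n} → (∀ history → Outcome N history n) → ∀ history → Outcome N history (suc n)
      round {n} next history = record
        { slots   = B ∷ idles j slots
        ; shape   = inj₁ refl VecAll.∷ shape-idles j shape
        ; load    = load-head (idles j slots)
        ; T       = e + min β (ι j * e) + T
        ; ne≤T    = ≤-by (min-glb 0≤β (ι-nonNeg j ⊛ 0≤e) ⊕ ⟪ ne≤T ⟫)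
            (solve 4 (λ n e u t → e :+ u :+ t := (:1 :+ n) :* e :+ (u :+ (t :- n :* e))) refl
              (ι n) e (min β (ι j * e)) T)
        ; online  = λ { full t full≡ refl (adm ∷ feasible) x₀ →
            let 1≤x = busy⇒on price slope adm
                V   = costFrom (decision full t) β P (idles j slots) (decisions full (suc t) (j ℕ.+ size))
            in ≤-by
              (⟪ online-gap full (suc t)
                   (trans full≡ (trans (cong (λ L → history ++ B ∷ L) (toList-idles j slots))
                     (sym (∷ʳ-++ history B _))))
                   (suc-length B history) feasible (decision full t) 1≤x ⟫
                ⊕ ⟪ round-ratio j q charge ⟫ ⊕ 0≤β+e ⊛ ⟪ busy-step x₀ 1≤x ⟫)
              (solve 10 (λ n b e m t q V r u f →
                  (b :+ e) :* (r :+ u :+ V :+ f) := n :* (e :+ m :+ t)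
                    :+ ((b :+ e) :* (V :+ b) :- (n :* t :+ (b :+ e) :* q)
                      :+ ((b :+ e) :* (q :+ e) :- n :* (e :+ m))
                      :+ (b :+ e) :* (r :+ u :+ f :- (e :+ b))))
                refl N β e (min β (ι j * e)) T q V (running P B (decision full t))
                  (β * [ ι (decision full t) - ι x₀ ]⁺) (φ x₀)) }
        ; offline = offline′ offline (total β (ι j * e))
        }
        where
        open GapOutcome (gap next (history List.∷ʳ B) f)
        offline′ : (∃ λ ys → Feasible P slots ys × costFrom 1 β P slots ys ≤ T) →
          β ≤ ι j * e ⊎ ι j * e ≤ β →
          ∃ λ ys → Feasible P (B ∷ idles j slots) ys ×
            costFrom 1 β P (B ∷ idles j slots) ys ≤ e + min β (ι j * e) + T
        offline′ (ys , feasible , ≤T) (inj₁ β≤je) =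
          1 ∷ (Vec.replicate j 0 Vec.++ ys) ,
          busy-on price slope ∷ feasible-idles j z≤n feasible ,
          ≤-trans (≤-reflexive (on-cost (ι i) (idles j slots) _))
            (≤-by (⟪ ≤-trans (leave-cost j slots ys 1 ℕₚ.≤-refl) (costFrom-0≤1+β slots ys) ⟫
                ⊕ ⟪ ≤T ⟫ ⊕ ⟪ min-glb ≤-refl β≤je ⟫)
              (solve 6 (λ e m b t W V → e :+ m :+ t := e :+ V :+ (W :+ b :- V :+ (t :- W) :+ (m :- b)))
                refl e (min β (ι j * e)) β T (costFrom 1 β P slots ys)
                  (costFrom 1 β P (idles j slots) (Vec.replicate j 0 Vec.++ ys))))
        offline′ (ys , feasible , ≤T) (inj₂ je≤β) =
          1 ∷ (Vec.replicate j 1 Vec.++ ys) ,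
          busy-on price slope ∷ feasible-idles j ℕₚ.≤-refl feasible ,
          ≤-trans (≤-reflexive (trans (on-cost (ι i) (idles j slots) _) (cong (e +_) (stay-cost j slots ys))))
            (≤-by (⟪ ≤T ⟫ ⊕ ⟪ min-glb je≤β ≤-refl ⟫)
              (solve 5 (λ e m s t W → e :+ m :+ t := e :+ (s :+ W) :+ (t :- W :+ (m :- s)))
                refl e (min β (ι j * e)) (ι j * e) T (costFrom 1 β P slots ys)))

      rounds : ∀ n history → Outcome N history n
      rounds zero    = lastRound
      rounds (suc n) = round (rounds n)

-- No smaller ratio is possible

module LowerBound {c ℓ} (F : ArchimedeanOrderedField c ℓ) (w : ℕ) (π : Provisioning.Parameters F) where

  open OrderedField F
  open Provisioning F
  open Parameters π
  open SlotProperties F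
  open LinearSlots F
  open CostDecomposition F (proj₁ 0<β) using (cost-nonNeg)

  module _ {P : Problem} {i : ℕ} (linear-P : Linear P i) (A : Online)
    {δ γ : Carrier} (0≤δ : 0# ≤ δ)
    (competitive : Competitive β P (Inputsᵢ i Pmin Pmax δ) w A γ)
    where

    open Linear linear-P

    module _ {p σ : Carrier} (Pmin≤p : Pmin ≤ p) (p≤Pmax : p ≤ Pmax) (δ≤σ : δ ≤ σ)
      (0<e : 0# < p * σ) where

      open Adversary F 0<β w A linear-P p σ 0<e

      private
        e = p * σ
        -- An opening slot of slope exactly δ fixes `dMin` at δ even if the adversary plays with a
        -- larger slope. Staying off in it is free.
        J = linear 0# Pmin δ

        enough : ∃ λ f → β + β ≤ ι f * e
        enough with f , 2β/e≤f ← archimedean ((β + β) * e ⁻¹) =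
          f , subst (_≤ ι f * e) (x*y⁻¹*y≡x (β + β) 0<e) (*-monoʳ-≤-nonNeg (proj₁ 0<e) 2β/e≤f)

      outcome-against-optimum : ∀ {N n} → Outcome N (J ∷ []) n →
        ∃ λ T → ∃ λ opt → ι n * e ≤ T × 0# ≤ opt × opt ≤ T + β × N * T ≤ (β + e) * (γ * opt)
      outcome-against-optimum {N} {n} outcome =
        T , cost β P ss y , ne≤T , cost-nonNeg P 0 ss y running-nonNeg′ , opt≤ , N*T≤
        where
        open Outcome outcome

        ss : Vec Slot (suc size)
        ss = J ∷ slots

        valid : VecAll.All (Valid Pmin Pmax) ss
        valid = linear-valid ≤-refl ≤-refl Pmin≤Pmax 0≤δ VecAll.∷ VecAll.map
          (λ { (inj₁ refl) → linear-valid (ι-nonNeg i) Pmin≤p p≤Pmax (≤-trans 0≤δ δ≤σ)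
             ; (inj₂ refl) → linear-valid ≤-refl Pmin≤p p≤Pmax (≤-trans 0≤δ δ≤σ) }) shape

        slope-J : d J 1 - d J 0 ≡ δ
        slope-J = linear-slope 0# Pmin δ

        dMin≡δ : dMin ss ≡ δ
        dMin≡δ = antisym (≤-trans (VecAll.head (dMin≤ ss)) (≤-reflexive slope-J))
          (dMin-glb ss (≤-reflexive (sym slope-J) VecAll.∷ VecAll.map
            (λ { (inj₁ refl) → ≤-trans δ≤σ (≤-reflexive (sym (linear-slope (ι i) p σ)))
               ; (inj₂ refl) → ≤-trans δ≤σ (≤-reflexive (sym (linear-slope 0# p σ))) }) shape))

        input : Inputsᵢ i Pmin Pmax δ ss
        input = (valid , dMin≡δ) , ℕₚ.≤-trans load (ℕₚ.m≤n⊔m ⌈ 0# ⌉ (maxLoad (toList slots)))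

        linear-mono : ∀ a {p σ} → 0# ≤ p → 0# ≤ σ → ∀ x →
          running P (linear a p σ) (1 ℕ.⊓ x) ≤ running P (linear a p σ) x
        linear-mono a {p} {σ} 0≤p 0≤σ x = subst₂ _≤_
          (sym (running-linear a p σ (1 ℕ.⊓ x))) (sym (running-linear a p σ x))
          (*-monoˡ-≤-nonNeg (0≤p ⊛ 0≤σ) (ι-mono (ℕₚ.m⊓n≤n 1 x)))

        0≤p : 0# ≤ p
        0≤p = ≤-trans 0≤Pmin Pmin≤p
        0≤σ : 0# ≤ σ
        0≤σ = ≤-trans 0≤δ δ≤σ

        optimal : ∃ (Optimal β P ss)
        optimal = Optimum.optimum F (proj₁ 0<β) P ss
          ((idle-≤1 Pmin δ ℕₚ.≤-refl , yes (idle-≤1 Pmin δ z≤n)) VecAll.∷ VecAll.map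
            (λ { (inj₁ refl) → busy-on p σ , no (λ adm → ℕₚ.1+n≰n (busy⇒on p σ adm))
               ; (inj₂ refl) → idle-≤1 p σ ℕₚ.≤-refl , yes (idle-≤1 p σ z≤n) }) shape)
          (linear-mono 0# 0≤Pmin 0≤δ VecAll.∷ VecAll.map
            (λ { (inj₁ refl) → linear-mono (ι i) 0≤p 0≤σ ; (inj₂ refl) → linear-mono 0# 0≤p 0≤σ }) shape)

        y = proj₁ optimal

        running-J : ∀ x → 0# ≤ running P J x
        running-J x = subst (0# ≤_) (sym (running-linear 0# Pmin δ x)) (0≤Pmin ⊛ 0≤δ ⊛ ι-nonNeg x)

        running-nonNeg′ : VecAll.All (λ s → ∀ x → 0# ≤ running P s x) ss
        running-nonNeg′ = running-J VecAll.∷ VecAll.map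
          (λ { (inj₁ refl) → running-nonNeg (ι i) ; (inj₂ refl) → running-nonNeg 0# }) shape

        opt≤ : cost β P ss y ≤ T + β
        -- The offline solution of the game starts from a server that is on; starting from none adds
        -- at most β.
        opt≤ with ys , feasible , ≤T ← offline = ≤-trans
          (proj₂ (proj₂ optimal) (0 ∷ ys) (idle-≤1 Pmin δ z≤n ∷ feasible))
          (≤-trans (≤-reflexive free) (≤-trans (costFrom-0≤1+β slots ys) (+-mono-≤ ≤T ≤-refl)))
          where
          free : cost β P ss (0 ∷ ys) ≡ costFrom 0 β P slots ys
          free rewrite running-linear 0# Pmin δ 0 | ι-decrease (z≤n {0}) =
            solve 3 (λ r b V → r :* :0 :+ b :* :0 :+ V := V) refl (Pmin * δ) β (costFrom 0 β P slots ys)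

        full = J ∷ toList slots
        x₁ = decision full 0
        xs = decisions full 1 size

        online-ratio : Feasible P ss (x₁ ∷ xs) → N * T ≤ (β + e) * cost β P ss (x₁ ∷ xs)
        online-ratio (_ ∷ feasible) = ≤-by
          (⟪ online full 1 refl refl feasible x₁ ⟫ ⊕ (proj₁ 0<β ⊕ proj₁ 0<e) ⊛ (running-J x₁ ⊕ ⟪ φ-step 0 x₁ ⟫))
          (solve 6 (λ k r u V f v → k :* (r :+ u :+ V)
              := v :+ (k :* (V :+ f) :- v :+ k :* (r :+ (u :+ :0 :- f))))
            refl (β + e) (running P J x₁) (β * [ ι x₁ - ι 0 ]⁺) (costFrom x₁ β P slots xs) (φ x₁) (N * T))

        N*T≤ : N * T ≤ (β + e) * (γ * cost β P ss y)
        N*T≤ with feasible , bound ← competitive ss input = ≤-trans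
          (subst (λ xs → Feasible P ss xs → N * T ≤ (β + e) * cost β P ss xs)
            (sym (run≡decisions ss)) online-ratio feasible)
          (*-monoˡ-≤-nonNeg (proj₁ 0<β ⊕ proj₁ 0<e) (bound y (proj₂ optimal)))

      against-optimum : ∀ N → N ≤ β ⊎ N + ι w * e ≤ β + β → ∀ n →
        ∃ λ T → ∃ λ opt → ι n * e ≤ T × 0# ≤ opt × opt ≤ T + β × N * T ≤ (β + e) * (γ * opt)
      against-optimum N N-small n = outcome-against-optimum
        (Game.rounds N N-small (proj₁ enough) (proj₂ enough) n (J ∷ []))

      -- The sign of γ is not given, but it is needed to replace the optimum by T + β in γ * opt.
      -- One full round ensures T ≥ e > 0, which a nonpositive γ contradicts.
      0≤γ : 0# ≤ γ
      0≤γ with total 0# γ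
      ... | inj₁ 0≤γ = 0≤γ
      ... | inj₂ γ≤0 = contradiction (βe≤0 (against-optimum β (inj₁ ≤-refl) 1)) (<⇒≱ (*-pos 0<β 0<e))
        where
        βe≤0 : (∃ λ T → ∃ λ opt → ι 1 * e ≤ T × 0# ≤ opt × opt ≤ T + β × β * T ≤ (β + e) * (γ * opt)) →
          β * e ≤ 0#
        βe≤0 (T , opt , e≤T , 0≤opt , _ , βT≤) = ≤-by
          (⟪ βT≤ ⟫ ⊕ proj₁ 0<β ⊛ ⟪ e≤T ⟫ ⊕ (proj₁ 0<β ⊕ proj₁ 0<e) ⊛ (⟪ γ≤0 ⟫ ⊛ 0≤opt))
          (solve 5 (λ b e g T o → :0 := b :* e :+ ((b :+ e) :* (g :* o) :- b :* T
              :+ b :* (T :- (:1 :+ :0) :* e) :+ (b :+ e) :* ((:0 :- g) :* o)))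
            refl β e γ T opt)

      -- Against ever more rounds the additive constant β in opt ≤ T + β vanishes.
      N-bound : ∀ N → N ≤ β ⊎ N + ι w * e ≤ β + β → N ≤ γ * (β + e)
      N-bound N N-small with N ≤? γ * (β + e)
      ... | yes N≤Y = N≤Y
      ... | no  N≰Y = contradiction (λ n → bounded n (against-optimum N N-small n))
        (multiples-unbounded (*-pos 0<e 0<N-Y))
        where
        Y = γ * (β + e)
        0<N-Y : 0# < N - Y
        0<N-Y = x<y⇒0<y-x (≰⇒> N≰Y)
        bounded : ∀ n →
          (∃ λ T → ∃ λ opt → ι n * e ≤ T × 0# ≤ opt × opt ≤ T + β × N * T ≤ (β + e) * (γ * opt)) →
          ι n * (e * (N - Y)) ≤ Y * β
        bounded n (T , opt , ne≤T , 0≤opt , opt≤ , NT≤) = ≤-by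
          (⟪ ne≤T ⟫ ⊛ proj₁ 0<N-Y ⊕ ⟪ NT≤ ⟫ ⊕ ((proj₁ 0<β ⊕ proj₁ 0<e) ⊛ (0≤γ ⊛ ⟪ opt≤ ⟫)))
          (solve 7 (λ k e N b g T o → g :* (b :+ e) :* b := k :* (e :* (N :- g :* (b :+ e)))
              :+ ((T :- k :* e) :* (N :- g :* (b :+ e)) :+ ((b :+ e) :* (g :* o) :- N :* T)
                :+ (b :+ e) :* (g :* (T :+ b :- o))))
            refl (ι n) e N β γ T opt)

    private
      m = δ * Pmin

    -- Idling has to be cheap but not free. When δ Pmin = 0 its cost is only
    -- arbitrarily small.
    idling-cost : 0# < Pmax → ∀ {e′} → 0# < e′ → ∃ λ p → ∃ λ σ →
      Pmin ≤ p × p ≤ Pmax × δ ≤ σ × 0# < p * σ × p * σ ≤ m + e′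
    idling-cost 0<Pmax {e′} 0<e′ with 0# ≟ δ | 0# ≟ Pmin
    ... | yes refl | _ = Pmax , e′ * Pmax ⁻¹ , Pmin≤Pmax , ≤-refl , proj₁ 0<σ , *-pos 0<Pmax 0<σ ,
      ≤-reflexive (trans (trans (solve 2 (λ p s → p :* s := s :* p) refl Pmax _) (x*y⁻¹*y≡x e′ 0<Pmax))
        (solve 2 (λ p e → e := :0 :* p :+ e) refl Pmin e′))
      where
      0<σ : 0# < e′ * Pmax ⁻¹
      0<σ = *-pos 0<e′ (⁻¹-pos 0<Pmax)
    ... | no 0≢δ | no 0≢Pmin = Pmin , δ , ≤-refl , Pmin≤Pmax , ≤-refl ,
      *-pos (0≤Pmin , 0≢Pmin) (0≤δ , 0≢δ) ,
      ≤-by (proj₁ 0<e′) (solve 3 (λ p d e → d :* p :+ e := p :* d :+ e) refl Pmin δ e′)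
    ... | no 0≢δ | yes refl = price , δ , proj₁ 0<price , min≤x Pmax _ , ≤-refl , *-pos 0<price 0<δ ,
      ≤-trans (*-monoʳ-≤-nonNeg 0≤δ (min≤y Pmax _)) (≤-reflexive (trans (x*y⁻¹*y≡x e′ 0<δ)
        (solve 2 (λ d e → e := d :* :0 :+ e) refl δ e′)))
      where
      0<δ : 0# < δ
      0<δ = 0≤δ , 0≢δ
      price = min Pmax (e′ * δ ⁻¹)
      0<price : 0# < price
      0<price with min-sel Pmax (e′ * δ ⁻¹)
      ... | inj₁ eq = subst (0# <_) (sym eq) 0<Pmax
      ... | inj₂ eq = subst (0# <_) (sym eq) (*-pos 0<e′ (⁻¹-pos 0<δ))

    optimal-at-δ : 0# < Pmax → 2-α w π δ ≤ γ * (1# + δ * Pmin * β ⁻¹)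
    optimal-at-δ 0<Pmax = *-cancelʳ-≤-pos 0<β (≤-trans (≤-limit (ι-nonNeg w ⊕ γ-nonNeg) approx)
      (≤-reflexive rescale))
      where
      0<1 : 0# < 1#
      0<1 = 0≤1 , 0≢1

      γ-nonNeg : 0# ≤ γ
      γ-nonNeg with p , σ , Pmin≤p , p≤Pmax , δ≤σ , 0<e , _ ← idling-cost 0<Pmax 0<1 =
        0≤γ Pmin≤p p≤Pmax δ≤σ 0<e

      -- The target (2 - α)β is lowered by w e′ because the idling cost e may exceed δ Pmin by up to
      -- e′; the loss vanishes in the limit. The two alternatives are the two values of the minimum
      -- α.
      N-small : ∀ {e e′} → 0# ≤ e′ → e ≤ m + e′ →
        2-α w π δ * β - ι w * e′ ≤ β ⊎ 2-α w π δ * β - ι w * e′ + ι w * e ≤ β + β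
      N-small {e} {e′} 0≤e′ e≤ with min-sel 1# (ι w * δ * Pmin * β ⁻¹)
      ... | inj₁ α≡1 = inj₁ (subst (λ a → (1# + 1# - a) * β - ι w * e′ ≤ β) (sym α≡1)
        (≤-by (ι-nonNeg w ⊛ 0≤e′)
          (solve 2 (λ b u → b := (:1 :+ :1 :- :1) :* b :- u :+ u) refl β (ι w * e′))))
      ... | inj₂ α≡ = inj₂ (≤-by (ι-nonNeg w ⊛ ⟪ e≤ ⟫) (trans
          (trans (solve 2 (λ b v → b :+ b := b :+ b :- v :+ v) refl β (ι w * δ * Pmin))
            (cong (λ v → β + β - v + ι w * δ * Pmin) (sym αβ≡)))
          (solve 7 (λ a b w d p e f → b :+ b :- a :* b :+ w :* d :* p
              := (:1 :+ :1 :- a) :* b :- w :* f :+ w :* e :+ w :* (d :* p :+ f :- e))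
            refl (α w π δ) β (ι w) δ Pmin e e′)))
        where
        αβ≡ : α w π δ * β ≡ ι w * δ * Pmin
        αβ≡ = trans (cong (_* β) α≡) (x*y⁻¹*y≡x (ι w * δ * Pmin) 0<β)

      approx : ∀ {e′} → 0# < e′ → 2-α w π δ * β ≤ γ * (β + m) + (ι w + γ) * e′
      approx {e′} 0<e′ with p , σ , Pmin≤p , p≤Pmax , δ≤σ , 0<e , e≤ ← idling-cost 0<Pmax 0<e′ =
        ≤-by (⟪ N-bound Pmin≤p p≤Pmax δ≤σ 0<e _ (N-small (proj₁ 0<e′) e≤) ⟫ ⊕ γ-nonNeg ⊛ ⟪ e≤ ⟫)
          (solve 7 (λ X g b m w e f → g :* (b :+ m) :+ (w :+ g) :* f
              := X :+ (g :* (b :+ e) :- (X :- w :* f) :+ g :* (m :+ f :- e)))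
            refl (2-α w π δ * β) γ β m (ι w) (p * σ) e′)

      rescale : γ * (β + m) ≡ γ * (1# + m * β ⁻¹) * β
      rescale = trans (cong (λ v → γ * (β + v)) (sym (x*y⁻¹*y≡x m 0<β)))
        (solve 4 (λ g b m u → g :* (b :+ m :* u :* b) := g :* (:1 :+ m :* u) :* b) refl γ β m (β ⁻¹))

  private
    -- At δ = 0 the factor 1 + δ Pmin / β is 1.
    fixed⇒optimal : ∀ {CompetitiveFor} →
      2-α-OptimalAtFixed-δ w π CompetitiveFor → 2-α-Optimal w π CompetitiveFor
    fixed⇒optimal fixed 0<Pmax A ε 0<ε competitive = <⇒≱ 0<ε (≤-by
      ⟪ fixed 0<Pmax A 0# (2-α w π 0# - ε) ≤-refl (competitive 0# ≤-refl) ⟫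
      (solve 4 (λ x e p b → :0 := e :+ ((x :- e) :* (:1 :+ :0 :* p :* b) :- x)) refl
        (2-α w π 0#) ε Pmin (β ⁻¹)))

  CPᵢ-optimalAtFixed-δ : ∀ i → 1 ℕ.≤ i → 2-α-OptimalAtFixed-δ w π (λ δ → CompetitiveForCPᵢ w π δ i)
  CPᵢ-optimalAtFixed-δ (suc j) _ 0<Pmax A δ γ 0≤δ competitive =
    optimal-at-δ (CPᵢ-linear j) A 0≤δ competitive 0<Pmax

  CP-optimalAtFixed-δ : 2-α-OptimalAtFixed-δ w π (CompetitiveForCP w π)
  CP-optimalAtFixed-δ 0<Pmax A δ γ 0≤δ competitive =
    optimal-at-δ CP-linear A 0≤δ (λ ss (inputs , _) → competitive ss inputs) 0<Pmax

  CPᵢ-optimal : ∀ i → 1 ℕ.≤ i → 2-α-Optimal w π (λ δ → CompetitiveForCPᵢ w π δ i)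
  CPᵢ-optimal i 1≤i = fixed⇒optimal (CPᵢ-optimalAtFixed-δ i 1≤i)

  CP-optimal : 2-α-Optimal w π (CompetitiveForCP w π)
  CP-optimal = fixed⇒optimal CP-optimalAtFixed-δ


open import Data.Nat.Base using (_≤_)
open Provisioning

theorem4 : ∀ {c ℓ} (F : ArchimedeanOrderedField c ℓ) (w : ℕ) (π : Parameters F) →
    α-Normalised F w π ×
    GCSRₛ-Achieves-2-α F w π ×
    GCSR-Achieves-2-α F w π ×
    (∀ i → 1 ≤ i → 2-α-Optimal F w π (λ δ → CompetitiveForCPᵢ F w π δ i)) ×
    2-α-Optimal F w π (CompetitiveForCP F w π) ×
    (∀ i → 1 ≤ i → 2-α-OptimalAtFixed-δ F w π (λ δ → CompetitiveForCPᵢ F w π δ i)) ×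
    2-α-OptimalAtFixed-δ F w π (CompetitiveForCP F w π)
theorem4 F w π =
  α-normalised , GCSRₛ-achieves , GCSR-achieves ,
  CPᵢ-optimal , CP-optimal , CPᵢ-optimalAtFixed-δ , CP-optimalAtFixed-δ
  where
  open Achievability F w π
  open LowerBound F w π
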